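{- (1) Let $((U,E;\partial),\underline c,\overline c,\beta)$ be a bisubmodular flow instance in which $\underline c,\overline c$ are integral and $\beta$ is reducible to an integral submodular function $\rho$. Then a half-integral feasible flow or a maximum violating cut of this instance can be obtained in $O(\mathrm{SF}(n,m,\eta))$ time, where $n=|U|$, $m=|E|$ and $\eta$ is the time complexity of an exchange capacity oracle for $\rho$. (2) If in addition $\beta$ is separable into bisubmodular functions $\beta_t$ on a partition $(U_1,\dots,U_\ell)$ of $U$, each $\beta_t$ reducible to an integral submodular function $\rho_t$ ($t=1,\dots,\ell$), then the half-integral feasible flow $\psi$ in (1) can be chosen so that $(\nabla\psi)(U_t)\in\mathbb{Z}$ for all $t=1,\dots,\ell$.
   Context: Notation: $U^\pm=U\times\{\pm1\}$, $i^\pm=(i,\pm1)$, $Y^\pm=\{i^\pm:i\in Y\}$; $\underline X$ removes from $X\subseteq U^\pm$ all pairs $\{i^+,i^-\}\subseteq X$. A submodular $\rho:2^{U^\pm}\to\mathbb{R}\cup\{+\infty\}$ ($\rho(\emptyset)=0$) is t-monotone if $\rho(\underline X)\le\rho(X)$; $\mathcal{B}(\rho)=\{x:x(U^\pm)=\rho(U^\pm),x(X)\le\rho(X)\ \forall X\}$; $\Phi(x)(i)=(x(i^+)-x(i^-))/2$; $\Psi(z)(i^+)=z(i)$, $\Psi(z)(i^-)=-z(i)$. A bisubmodular $\beta:3^U\to\mathbb{R}\cup\{+\infty\}$ ($3^U$ = disjoint pairs $(Y,Z)$ of subsets of $U$) is reducible to $\rho$ if $\rho$ is t-monotone submodular,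 $\Psi(\Phi(\mathcal{B}(\rho)))\subseteq\mathcal{B}(\rho)$ and $\beta(Y,Z)=\rho(Y^+\cup Z^-)$. $\beta$ is separable into $\beta_t$ on a partition $(U_1,\dots,U_\ell)$ if $\beta(Y,Z)=\sum_t\beta_t(Y\cap U_t,Z\cap U_t)$. Bisubmodular flow instance: bidirected graph $(U,E;\partial)$ ($\partial e\in\{\pm\chi_i\pm\chi_j\}$ for $e=ij$, self-loops only of types $\pm(\chi_i+\chi_i)$), capacities $\underline c\le\overline c$; a feasible flow is $\psi:E\to\mathbb{R}$ with $\underline c\le\psi\le\overline c$ and $\nabla\psi:=\sum_e\psi(e)\partial e\in\mathcal{D}(\beta)=\{z:z(Y)-z(Z)\le\beta(Y,Z)\ \forall (Y,Z)\}$. A violating cut is $(Y,Z)\in3^U$ with $\hat\kappa(Y,Z)>\beta(Y,Z)$, where $\hat\kappa(Y,Z)=\sum\{\langle\partial e,\chi_{Y,Z}\rangle\underline c(e):\langle\partial e,\chi_{Y,Z}\rangle>0\}+\sum\{\langle\partial e,\chi_{Y,Z}\rangle\overline c(e):\langle\partial e,\chi_{Y,Z}\rangle<0\}$, $\chi_{Y,Z}=\sum_{i\in Y}\chi_i-\sum_{j\in Z}\chi_j$; it is maximum if it maximizes $\hat\kappa-\beta$ among violating cuts. Half-integral means $2\psi$ integer-valued. $\mathrm{SF}(n',m',\eta)$: the time complexity of solving the submodular flow problem (given a directed graph on $n'$ nodes and $m'$ arcs with lower/upper arc capacities and a submodular $\rho'$ with $\rho'(\emptyset)=\rho'(\text{ground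 set})=0$ accessed through an exchange capacity oracle of time $\eta$, find $\varphi$ within capacities whose boundary (outflow minus inflow) lies in $\mathcal{B}(\rho')$, integral for integral data, or else a maximum violating cut $X$ maximizing $\kappa(X)-\rho'(X)>0$ where $\kappa(X)$ is the sum of lower capacities of arcs leaving $X$ minus the sum of upper capacities of arcs entering $X$). The exchange capacity for $x\in\mathcal{B}(\rho')$ and distinct $i,j$ is $\min\{\rho'(X)-x(X): i\in X\not\ni j\}$.
   Formalization: The formal statement assumes that SF(n,m,η) is at least linear in n+m and that SF(2n,2m,η)=O(SF(n,m,η)); an integral base accompanies each exchange capacity oracle; in (2) the oracle is for ρ(X)=Σ_t ρ_t(X∩U_t^±). -}

module Defs where

open import Data.Bool.Base using (Bool; if_then_else_; _∧_; not)
open import Data.Fin.Base using (Fin; toℕ; _↑ˡ_; _↑ʳ_)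
import Data.Fin.Properties as Fin
open import Data.Fin.Subset using (Subset; _∈_; _∉_; _⊆_; _∩_; _∪_; _─_; ⊥; ⊤)
open import Data.Integer.Base as ℤ using (ℤ; +_; _◃_)
import Data.Integer.Properties as ℤ
open import Data.Nat.Base as ℕ using (ℕ; suc)
import Data.Nat.Properties as ℕ
open import Data.Product using (Σ; ∃; ∃-syntax; ∃!; _×_; _,_)
open import Data.Rational.Base as ℚ
  using (ℚ; 0ℚ; 1ℚ; ½; _+_; _-_; _*_; -_; _≤_; _<_; _/_)
import Data.Rational.Properties as ℚ
open import Data.Sign.Base using (Sign)
open import Data.Sum.Base using (_⊎_)
open import Data.Vec.Base using (_++_; lookup)
import Data.Vec.Functional as F
open import Relation.Binary.PropositionalEquality using (_≡_; _≢_)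
open import Relation.Nullary using (¬_; does)
open import Relation.Nullary.Construct.Add.Supremum using (_⁺; [_]; ⊤⁺)

open import Algebra.Properties.CommutativeMonoid.Sum ℚ.+-0-commutativeMonoid
  public using (sum)
open import Relation.Binary.Construct.Add.Supremum.NonStrict _≤_ public using (_≤⁺_)
open import Relation.Binary.Construct.Add.Supremum.Strict _<_ public using (_<⁺_)

private variable n m k ℓ : ℕ

------------------------------------------------------------------------
-- Numbers.  The rationals play the role of ℝ.  All data used below
-- are integral, and for integral ρ a linear inclusion between base
-- polyhedra holds over ℚ iff it holds over ℝ.

fromℤ : ℤ → ℚ
fromℤ z = z / 1

Integral : ℚ → Set
Integral q = ∃[ z ] q ≡ fromℤ z

ℚ∞ : Set
ℚ∞ = ℚ ⁺

infixl 6 _+∞_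

_+∞_ : ℚ∞ → ℚ∞ → ℚ∞
[ p ] +∞ [ q ] = [ p + q ]
[ p ] +∞ ⊤⁺    = ⊤⁺
⊤⁺    +∞ q     = ⊤⁺

sum∞ : (Fin k → ℚ∞) → ℚ∞
sum∞ = F.foldr _+∞_ [ 0ℚ ]

fromℤ∞ : ℤ ⁺ → ℚ∞
fromℤ∞ [ z ] = [ fromℤ z ]
fromℤ∞ ⊤⁺    = ⊤⁺

------------------------------------------------------------------------
-- Vectors and subsets

_⟨_⟩ : (Fin k → ℚ) → Subset k → ℚ
x ⟨ X ⟩ = sum (λ i → if lookup X i then x i else 0ℚ)

𝟙 : Subset k → Fin k → ℚ
𝟙 X i = if lookup X i then 1ℚ else 0ℚ

unit : Fin k → Fin k → ℚ
unit i j = if does (i Fin.≟ j) then 1ℚ else 0ℚ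

χ : Subset k → Subset k → Fin k → ℚ
χ Y Z i = 𝟙 Y i - 𝟙 Z i

Disjoint : Subset k → Subset k → Set
Disjoint Y Z = ∀ {i} → i ∈ Y → i ∉ Z

------------------------------------------------------------------------
-- Submodular functions and base polyhedra.  Functions are total on the
-- subsets of Fin k, but the ground set may be any G ⊆ Fin k: only the values
-- at subsets of G (and only the coordinates in G) are ever constrained.

SubmodularOn : Subset k → (Subset k → ℚ∞) → Set
SubmodularOn G ρ =
  ρ ⊥ ≡ [ 0ℚ ] ×
  (∀ X X′ → X ⊆ G → X′ ⊆ G → ρ (X ∪ X′) +∞ ρ (X ∩ X′) ≤⁺ ρ X +∞ ρ X′)

IntegralOn : Subset k → (Subset k → ℚ∞) → Set
IntegralOn G ρ = ∀ X → X ⊆ G → ∀ {q} → ρ X ≡ [ q ] → Integral q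

Base : Subset k → (Subset k → ℚ∞) → (Fin k → ℚ) → Set
Base G ρ x = [ x ⟨ G ⟩ ] ≡ ρ G × (∀ X → X ⊆ G → [ x ⟨ X ⟩ ] ≤⁺ ρ X)

------------------------------------------------------------------------
-- Signed ground sets.  For U ⊆ Fin n, the set U^± is U ++ U ⊆ Fin (n + n):
-- i⁺ is i ↑ˡ n and i⁻ is n ↑ʳ i, so Y⁺ ∪ Z⁻ is Y ++ Z.

_± : Subset n → Subset (n ℕ.+ n)
U ± = U ++ U

Φ : (Fin (n ℕ.+ n) → ℚ) → (Fin n → ℚ)
Φ {n} x i = (x (i ↑ˡ n) - x (n ↑ʳ i)) * ½

Ψ : (Fin n → ℚ) → (Fin (n ℕ.+ n) → ℚ)
Ψ z = z F.++ (λ i → - z i)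

-- The set obtained from Y⁺ ∪ Z⁻ by removing all pairs {i⁺, i⁻} is
-- (Y ∖ Z)⁺ ∪ (Z ∖ Y)⁻.
TMonotoneOn : Subset n → (Subset (n ℕ.+ n) → ℚ∞) → Set
TMonotoneOn U ρ =
  ∀ Y Z → Y ⊆ U → Z ⊆ U → ρ ((Y ─ Z) ++ (Z ─ Y)) ≤⁺ ρ (Y ++ Z)

-- A function on 3^U is given by a function on all pairs of subsets; its
-- values at non-disjoint pairs are irrelevant.
BisubmodularOn : Subset n → (Subset n → Subset n → ℚ∞) → Set
BisubmodularOn U β =
  β ⊥ ⊥ ≡ [ 0ℚ ] ×
  (∀ Y Z Y′ Z′ → Y ⊆ U → Z ⊆ U → Y′ ⊆ U → Z′ ⊆ U →
    Disjoint Y Z → Disjoint Y′ Z′ →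
    β (Y ∩ Y′) (Z ∩ Z′) +∞ β ((Y ∪ Y′) ─ (Z ∪ Z′)) ((Z ∪ Z′) ─ (Y ∪ Y′))
      ≤⁺ β Y Z +∞ β Y′ Z′)

record ReducibleOn {n : ℕ} (U : Subset n) (β : Subset n → Subset n → ℚ∞)
                   (ρ : Subset (n ℕ.+ n) → ℚ∞) : Set where
  field
    submodular : SubmodularOn (U ±) ρ
    t-monotone : TMonotoneOn U ρ
    ΨΦ-closed  : ∀ x → Base (U ±) ρ x → Base (U ±) ρ (Ψ {n} (Φ {n} x))
    represents : ∀ Y Z → Y ⊆ U → Z ⊆ U → Disjoint Y Z → β Y Z ≡ ρ (Y ++ Z)

IsPartition : (Fin ℓ → Subset n) → Set
IsPartition U = ∀ i → ∃! _≡_ λ t → i ∈ U t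

Separable : (Fin ℓ → Subset n) → (Subset n → Subset n → ℚ∞) →
            (Fin ℓ → Subset n → Subset n → ℚ∞) → Set
Separable U β βs =
  ∀ Y Z → Disjoint Y Z → β Y Z ≡ sum∞ (λ t → βs t (Y ∩ U t) (Z ∩ U t))

⨁ : (Fin ℓ → Subset n) → (Fin ℓ → Subset (n ℕ.+ n) → ℚ∞) → Subset (n ℕ.+ n) → ℚ∞
⨁ U ρs X = sum∞ (λ t → ρs t (X ∩ (U t ±)))

------------------------------------------------------------------------
-- Submodular flow

record SubmodularFlow (n m : ℕ) : Set where
  field
    tail head   : Fin m → Fin n
    lower upper : Fin m → ℚ
    lower≤upper : ∀ a → lower a ≤ upper a
    ρ           : Subset n → ℚ∞
    submodular  : SubmodularOn ⊤ ρ
    ρ⊤≡0        : ρ ⊤ ≡ [ 0ℚ ]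

  boundary : (Fin m → ℚ) → (Fin n → ℚ)
  boundary φ v = sum (λ a → φ a * (unit (tail a) v - unit (head a) v))

  Feasible : (Fin m → ℚ) → Set
  Feasible φ = (∀ a → lower a ≤ φ a × φ a ≤ upper a) × Base ⊤ ρ (boundary φ)

  κ : Subset n → ℚ
  κ X = sum λ a →
    if lookup X (tail a) ∧ not (lookup X (head a)) then lower a
    else if not (lookup X (tail a)) ∧ lookup X (head a) then - upper a
    else 0ℚ

  ViolatingCut : Subset n → Set
  ViolatingCut X = ρ X <⁺ [ κ X ]

  -- ρ is finite at violating cuts, so the inequality says
  -- κ X′ - ρ X′ ≤ κ X - ρ X.
  MaximumViolatingCut : Subset n → Set
  MaximumViolatingCut X = ViolatingCut X ×
    (∀ X′ → ViolatingCut X′ → [ κ X′ ] +∞ ρ X ≤⁺ [ κ X ] +∞ ρ X′)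

  IntegralData : Set
  IntegralData = (∀ a → Integral (lower a) × Integral (upper a)) × IntegralOn ⊤ ρ

------------------------------------------------------------------------
-- Bisubmodular flow

record BidirectedEdge (n : ℕ) : Set where
  field
    end₁ end₂   : Fin n
    sign₁ sign₂ : Sign
    loop        : end₁ ≡ end₂ → sign₁ ≡ sign₂

  ∂ : Fin n → ℚ
  ∂ i = fromℤ (sign₁ ◃ 1) * unit end₁ i + fromℤ (sign₂ ◃ 1) * unit end₂ i

record BisubmodularFlow (n m : ℕ) : Set where
  field
    edge         : Fin m → BidirectedEdge n
    lower upper  : Fin m → ℚ
    lower≤upper  : ∀ e → lower e ≤ upper e
    β            : Subset n → Subset n → ℚ∞
    bisubmodular : BisubmodularOn ⊤ β

  open module Edge (e : Fin m) = BidirectedEdge (edge e) public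

  ∇ : (Fin m → ℚ) → (Fin n → ℚ)
  ∇ ψ i = sum (λ e → ψ e * ∂ e i)

  Feasible : (Fin m → ℚ) → Set
  Feasible ψ = (∀ e → lower e ≤ ψ e × ψ e ≤ upper e) ×
    (∀ Y Z → Disjoint Y Z → [ ∇ ψ ⟨ Y ⟩ - ∇ ψ ⟨ Z ⟩ ] ≤⁺ β Y Z)

  κ̂ : Subset n → Subset n → ℚ
  κ̂ Y Z = sum λ e → let p = sum (λ i → ∂ e i * χ Y Z i) in
    if does (0ℚ ℚ.<? p) then p * lower e
    else if does (p ℚ.<? 0ℚ) then p * upper e
    else 0ℚ

  ViolatingCut : Subset n → Subset n → Set
  ViolatingCut Y Z = Disjoint Y Z × β Y Z <⁺ [ κ̂ Y Z ]

  MaximumViolatingCut : Subset n → Subset n → Set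
  MaximumViolatingCut Y Z = ViolatingCut Y Z ×
    (∀ Y′ Z′ → ViolatingCut Y′ Z′ →
      [ κ̂ Y′ Z′ ] +∞ β Y Z ≤⁺ [ κ̂ Y Z ] +∞ β Y′ Z′)

  IntegralCapacities : Set
  IntegralCapacities = ∀ e → Integral (lower e) × Integral (upper e)

HalfIntegral : (Fin m → ℚ) → Set
HalfIntegral ψ = ∀ e → Integral (fromℤ (+ 2) * ψ e)

------------------------------------------------------------------------
-- The machine.  Running times are those of programs in a small imperative
-- language over integer arrays.  Every operation is charged: each
-- evaluation of an expression costs its number of symbols, addition,
-- subtraction and comparison of integers take unit time, and a call of the
-- exchange capacity oracle takes time η (plus one).  There is no
-- multiplication, so unit-cost arithmetic has no unrealistic power.

Array : Set
Array = ℤ → ℤ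

Store : Set
Store = ℕ → Array

_[_,_≔_] : Store → ℕ → ℤ → ℤ → Store
(s [ a , i ≔ v ]) b j = if does (a ℕ.≟ b) ∧ does (i ℤ.≟ j) then v else s b j

infixl 6 _⊕_ _⊖_

data Expr : Set where
  lit     : ℤ → Expr
  read    : ℕ → Expr → Expr
  _⊕_ _⊖_ : Expr → Expr → Expr

size : Expr → ℕ
size (lit _)    = 1
size (read _ e) = suc (size e)
size (e ⊕ f)    = suc (size e ℕ.+ size f)
size (e ⊖ f)    = suc (size e ℕ.+ size f)

⟦_⟧ : Expr → Store → ℤ
⟦ lit z    ⟧ s = z
⟦ read a e ⟧ s = s a (⟦ e ⟧ s)
⟦ e ⊕ f    ⟧ s = ⟦ e ⟧ s ℤ.+ ⟦ f ⟧ s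
⟦ e ⊖ f    ⟧ s = ⟦ e ⟧ s ℤ.- ⟦ f ⟧ s

infixr 5 _⨾_

data Cmd : Set where
  skip    : Cmd
  write   : ℕ → Expr → Expr → Cmd
  _⨾_     : Cmd → Cmd → Cmd
  if≤     : Expr → Expr → Cmd → Cmd → Cmd
  while≤  : Expr → Expr → Cmd → Cmd
  -- query x i j r: exchange capacity of the vector in array x for nodes i
  -- and j, returned in array r.
  query   : ℕ → Expr → Expr → ℕ → Cmd

Oracle : Set
Oracle = Array → ℤ → ℤ → ℤ ⁺

-- Cell 0 receives 1 for a finite answer, which is put into cell 1, and 0 for
-- the answer +∞.
answer : Store → ℕ → ℤ ⁺ → Store
answer s r [ v ] = (s [ r , + 0 ≔ + 1 ]) [ r , + 1 ≔ v ]
answer s r ⊤⁺    = s [ r , + 0 ≔ + 0 ]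

-- Run O η c s t s′: with oracle O of time η, the program c started in s
-- halts in s′ after time t.
data Run (O : Oracle) (η : ℕ) : Cmd → Store → ℕ → Store → Set where
  skip : ∀ {s} → Run O η skip s 1 s
  write : ∀ {s a e f} →
    Run O η (write a e f) s (suc (size e ℕ.+ size f)) (s [ a , ⟦ e ⟧ s ≔ ⟦ f ⟧ s ])
  _⨾_ : ∀ {s s′ s″ c d t t′} → Run O η c s t s′ → Run O η d s′ t′ s″ →
    Run O η (c ⨾ d) s (t ℕ.+ t′) s″
  if-true : ∀ {s s′ e f c d t} → ⟦ e ⟧ s ℤ.≤ ⟦ f ⟧ s → Run O η c s t s′ →
    Run O η (if≤ e f c d) s (suc (size e ℕ.+ size f ℕ.+ t)) s′
  if-false : ∀ {s s′ e f c d t} → ¬ ⟦ e ⟧ s ℤ.≤ ⟦ f ⟧ s → Run O η d s t s′ →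
    Run O η (if≤ e f c d) s (suc (size e ℕ.+ size f ℕ.+ t)) s′
  while-true : ∀ {s s′ s″ e f c t t′} → ⟦ e ⟧ s ℤ.≤ ⟦ f ⟧ s →
    Run O η c s t s′ → Run O η (while≤ e f c) s′ t′ s″ →
    Run O η (while≤ e f c) s (suc (size e ℕ.+ size f ℕ.+ (t ℕ.+ t′))) s″
  while-false : ∀ {s e f c} → ¬ ⟦ e ⟧ s ℤ.≤ ⟦ f ⟧ s →
    Run O η (while≤ e f c) s (suc (size e ℕ.+ size f)) s
  query : ∀ {s x i j r} →
    Run O η (query x i j r) s (suc (size i ℕ.+ size j ℕ.+ η))
      (answer s r (O (s x) (⟦ i ⟧ s) (⟦ j ⟧ s)))

------------------------------------------------------------------------
-- Data in the store.  Cells not mentioned contain arbitrary values.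

pos : Fin k → ℤ
pos i = + toℕ i

Holds : Array → (Fin k → ℚ) → Set
Holds A x = ∀ i → fromℤ (A (pos i)) ≡ x i

HoldsNodes : Array → (Fin m → Fin n) → Set
HoldsNodes A v = ∀ a → A (pos a) ≡ pos (v a)

HoldsSigns : Array → (Fin m → Sign) → Set
HoldsSigns A σ = ∀ a → A (pos a) ≡ σ a ◃ 1

-- Nothing is promised about answers for vectors that are not bases.
IsExchangeOracle : (Subset k → ℚ∞) → Oracle → Set
IsExchangeOracle {k} ρ O =
  ∀ A (x : Fin k → ℚ) → Holds A x → Base ⊤ ρ x → ∀ i j → i ≢ j →
    let c = fromℤ∞ (O A (pos i) (pos j)) in
    (∀ X → i ∈ X → j ∉ X → c +∞ [ x ⟨ X ⟩ ] ≤⁺ ρ X) ×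
    (∃[ X ] (i ∈ X × j ∉ X × c +∞ [ x ⟨ X ⟩ ] ≡ ρ X))

sizes ends₁ ends₂ lowers uppers base flag result signs₁ signs₂ : ℕ
sizes  = 0
ends₁  = 1
ends₂  = 2
lowers = 3
uppers = 4
base   = 5
flag   = 6
result = 7
signs₁ = 8
signs₂ = 9

-- The exchange capacity oracle only gives information at bases; as usual, an
-- (integral) base is supplied together with it.
HoldsBase : (Subset k → ℚ∞) → Array → Set
HoldsBase ρ A = ∃[ x ] (Holds A x × Base ⊤ ρ x)

record SubmodularFlowInput (I : SubmodularFlow n m) (s : Store) : Set where
  open SubmodularFlow I
  field
    #nodes  : s sizes (+ 0) ≡ + n
    #arcs   : s sizes (+ 1) ≡ + m
    tails   : HoldsNodes (s ends₁) tail
    heads   : HoldsNodes (s ends₂) head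
    lows    : Holds (s lowers) lower
    ups     : Holds (s uppers) upper
    a-base  : HoldsBase ρ (s base)

SubmodularFlowOutput : SubmodularFlow n m → Store → Set
SubmodularFlowOutput I s =
  (s flag (+ 0) ≡ + 0 × ∃[ φ ] (Holds (s result) φ × Feasible φ)) ⊎
  (s flag (+ 0) ≡ + 1 × ∃[ X ] (Holds (s result) (𝟙 X) × MaximumViolatingCut X))
  where open SubmodularFlow I

-- The node i⁺ is numbered i and the node i⁻ is numbered n + i.
record BisubmodularFlowInput (I : BisubmodularFlow n m)
         (ρ : Subset (n ℕ.+ n) → ℚ∞) (s : Store) : Set where
  open BisubmodularFlow I
  field
    #nodes  : s sizes (+ 0) ≡ + n
    #edges  : s sizes (+ 1) ≡ + m
    firsts  : HoldsNodes (s ends₁) end₁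
    seconds : HoldsNodes (s ends₂) end₂
    signs   : HoldsSigns (s signs₁) sign₁ × HoldsSigns (s signs₂) sign₂
    lows    : Holds (s lowers) lower
    ups     : Holds (s uppers) upper
    a-base  : HoldsBase ρ (s base)

-- A half-integral flow ψ is returned as 2ψ and a cut (Y , Z) as χ_{Y,Z}.
BisubmodularFlowOutput : BisubmodularFlow n m → ((Fin m → ℚ) → Set) → Store → Set
BisubmodularFlowOutput I Wanted s =
  (s flag (+ 0) ≡ + 0 ×
    ∃[ ψ ] (Holds (s result) (λ e → fromℤ (+ 2) * ψ e) ×
            Feasible ψ × HalfIntegral ψ × Wanted ψ)) ⊎
  (s flag (+ 0) ≡ + 1 ×
    ∃[ Y ] ∃[ Z ] (Holds (s result) (χ Y Z) × MaximumViolatingCut Y Z))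
  where open BisubmodularFlow I

------------------------------------------------------------------------
-- Time complexity

-- Q solves the submodular flow problem with integral data in time SF.
SolvesSubmodularFlow : Cmd → (ℕ → ℕ → ℕ → ℕ) → Set
SolvesSubmodularFlow Q SF =
  ∀ {n m} (I : SubmodularFlow n m) → SubmodularFlow.IntegralData I →
  ∀ O → IsExchangeOracle (SubmodularFlow.ρ I) O →
  ∀ η s → SubmodularFlowInput I s →
  ∃[ t ] ∃[ s′ ] (Run O η Q s t s′ × t ℕ.≤ SF n m η × SubmodularFlowOutput I s′)

-- With oracle access to ρ, the program P obtains, within the time bound T of
-- the oracle time, a half-integral feasible flow with property Wanted or a
-- maximum violating cut.
ObtainsFlowOrCut : Cmd → (ℕ → ℕ) → BisubmodularFlow n m →
                   (Subset (n ℕ.+ n) → ℚ∞) → ((Fin m → ℚ) → Set) → Set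
ObtainsFlowOrCut P T I ρ Wanted =
  ∀ O → IsExchangeOracle ρ O →
  ∀ η s → BisubmodularFlowInput I ρ s →
  ∃[ t ] ∃[ s′ ] (Run O η P s t s′ × t ℕ.≤ T η × BisubmodularFlowOutput I Wanted s′)

-- The usual assumptions on a time bound when it is used inside O(·): it is
-- at least linear in the size of the graph and grows at most by a constant
-- factor when the graph is doubled.
record RegularBound (SF : ℕ → ℕ → ℕ → ℕ) : Set where
  field
    K        : ℕ
    linear   : ∀ n m η → suc (n ℕ.+ m) ℕ.≤ K ℕ.* SF n m η
    doubling : ∀ n m η → SF (n ℕ.+ n) (m ℕ.+ m) η ℕ.≤ K ℕ.* SF n m η

{-# OPTIONS --safe #-}

-- Each edge of type s χᵢ + t χⱼ is replaced by the two mirror-image arcs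
-- i^s → j^{-t} and j^t → i^{-s} on U^±, with the capacities of the edge.  If
-- φ is an integral submodular flow of the resulting graph, then the mean ψ of
-- φ over the two arcs of an edge satisfies ∇ψ = Φ(∂φ), and ΨΦ-closedness of
-- B(ρ) turns ∂φ ∈ B(ρ) into feasibility of ψ.  A cut X is replaced by X with
-- all pairs {i⁺, i⁻} removed: this is the intersection of X with the
-- complement of its mirror image, so κ does not decrease by supermodularity
-- and symmetry, and ρ does not increase by t-monotonicity.  In the separable
-- case ∂φ sums to 0 over each U_t^±, which makes (∇ψ)(U_t) the sum of ∂φ over
-- U_t⁺, an integer.

module Submission where

open import Defs
open import Data.Fin.Base using (Fin)
open import Data.Fin.Subset using (Subset; ⊤)
open import Data.Nat.Base using (ℕ; _+_; _*_)
open import Data.Product using (∃-syntax; _×_)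
import Data.Unit

open import Algebra.Bundles using (CommutativeRing)
open import Data.Bool.Base using (Bool; true; false; if_then_else_; _∧_; not)
open import Data.Fin.Base using (zero; suc; toℕ; fromℕ<; _↑ˡ_; _↑ʳ_; splitAt)
import Data.Fin.Properties as Fin
open import Data.Fin.Subset using (_∈_; _⊆_; _∩_; _∪_; _─_; ⊥)
import Data.Fin.Subset.Properties as Subset
open import Data.Integer.Base as ℤ using (ℤ; +_; _◃_)
import Data.Integer.Properties as ℤ
open import Data.List.Base as List using (List; []; _∷_)
open import Data.Nat.Base as ℕ using (suc)
import Data.Nat.Properties as ℕ
open import Data.Product using (_,_; proj₁; proj₂)
open import Data.Rational.Base as ℚ using (ℚ; 0ℚ; 1ℚ; ½)
import Data.Rational.Properties as ℚ
open import Data.Rational.Solver using (module +-*-Solver)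
import Data.Rational.Unnormalised.Base as ℚᵘ
import Data.Rational.Unnormalised.Properties as ℚᵘ
open import Data.Sign.Base as Sign using (Sign)
open import Data.Sum.Base using (_⊎_; inj₁; inj₂)
open import Data.Vec.Base using (_∷_; _++_; lookup; tabulate)
import Data.Vec.Functional as F
import Data.Vec.Functional.Properties as F
import Data.Vec.Properties as Vec
open import Function.Base using (_∘_)
open import Relation.Binary.PropositionalEquality
open import Relation.Nullary using (¬_; does; yes; no; contradiction)
open import Relation.Nullary.Construct.Add.Supremum using ([_]; ⊤⁺; []-injective)
open import Relation.Nullary.Decidable using (dec-true; dec-false)
open import Relation.Binary.Construct.Add.Supremum.NonStrict ℚ._≤_ using ([_]; _≤⊤⁺; ≤⁺-trans)
open import Relation.Binary.Construct.Add.Supremum.Strict ℚ._<_ using ([_])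
open import Algebra.Properties.CommutativeMonoid.Sum ℚ.+-0-commutativeMonoid
  using (sum-cong-≗; ∑-distrib-+; ∑-comm; sum-replicate-zero)
open import Algebra.Properties.Group ℚ.+-0-group using (∙-cancelˡ)
open import Algebra.Properties.Semiring.Sum (CommutativeRing.semiring ℚ.+-*-commutativeRing)
  using (*-distribˡ-sum; *-distribʳ-sum)

-- Reducibility does not say that ρ(U^±) = 0, which a submodular flow instance requires. It follows
-- once B(ρ) has a point x: Ψ(Φ(x)) is again a base, and its total is 0. The base that accompanies
-- the exchange oracle supplies x. In part (2) the same argument is made for each ρ_t separately;
-- for this ∂φ must be a base of every block, and it is, because the inequalities ∂φ(U_t^±) ≤
-- ρ_t(U_t^±) add up to an equality. Otherwise part (2) is part (1) for the direct sum of the ρ_t,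
-- so one program serves both.
--
-- The oracle for ρ is already the oracle of the doubled graph, so nothing has to be simulated. The
-- solver Q is arbitrary and may overwrite its input; whatever is needed after the call is kept in
-- an array whose number lies above all those that Q writes. Integrality has its source in the
-- store: array entries are integers, so φ is integral and halves enter only through the mean over
-- two arcs.

private variable
  n m k ℓ : ℕ

-- Integral rationals

fromℤ-homo-+ : ∀ a b → fromℤ (a ℤ.+ b) ≡ fromℤ a ℚ.+ fromℤ b
-- `z / 1` is normalised by a gcd and does not reduce for a variable `z`. Among unnormalised
-- rationals it is equivalent to `mkℚᵘ z 0`, where addition computes.
fromℤ-homo-+ a b = ℚ.toℚᵘ-injective (begin
  ℚ.toℚᵘ (fromℤ (a ℤ.+ b))                       ≈⟨ ℚ.toℚᵘ-fromℚᵘ (ℚᵘ.mkℚᵘ (a ℤ.+ b) 0) ⟩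
  ℚᵘ.mkℚᵘ (a ℤ.+ b) 0                            ≈⟨ ℚᵘ.*≡* (cong (ℤ._* + 1) (sym (cong₂ ℤ._+_ (ℤ.*-identityʳ a) (ℤ.*-identityʳ b)))) ⟩
  ℚᵘ.mkℚᵘ a 0 ℚᵘ.+ ℚᵘ.mkℚᵘ b 0                   ≈⟨ ℚᵘ.+-cong (ℚ.toℚᵘ-fromℚᵘ (ℚᵘ.mkℚᵘ a 0)) (ℚ.toℚᵘ-fromℚᵘ (ℚᵘ.mkℚᵘ b 0)) ⟨
  ℚ.toℚᵘ (fromℤ a) ℚᵘ.+ ℚ.toℚᵘ (fromℤ b)         ≈⟨ ℚ.toℚᵘ-homo-+ (fromℤ a) (fromℤ b) ⟨
  ℚ.toℚᵘ (fromℤ a ℚ.+ fromℤ b)                   ∎)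
  where open ℚᵘ.≃-Reasoning

fromℤ-homo-* : ∀ a b → fromℤ (a ℤ.* b) ≡ fromℤ a ℚ.* fromℤ b
fromℤ-homo-* a b = ℚ.toℚᵘ-injective (begin
  ℚ.toℚᵘ (fromℤ (a ℤ.* b))                       ≈⟨ ℚ.toℚᵘ-fromℚᵘ (ℚᵘ.mkℚᵘ (a ℤ.* b) 0) ⟩
  ℚᵘ.mkℚᵘ a 0 ℚᵘ.* ℚᵘ.mkℚᵘ b 0                   ≈⟨ ℚᵘ.*-cong (ℚ.toℚᵘ-fromℚᵘ (ℚᵘ.mkℚᵘ a 0)) (ℚ.toℚᵘ-fromℚᵘ (ℚᵘ.mkℚᵘ b 0)) ⟨
  ℚ.toℚᵘ (fromℤ a) ℚᵘ.* ℚ.toℚᵘ (fromℤ b)         ≈⟨ ℚ.toℚᵘ-homo-* (fromℤ a) (fromℤ b) ⟨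
  ℚ.toℚᵘ (fromℤ a ℚ.* fromℤ b)                   ∎)
  where open ℚᵘ.≃-Reasoning

fromℤ-homo‿- : ∀ a → fromℤ (ℤ.- a) ≡ ℚ.- fromℤ a
fromℤ-homo‿- a = begin
  fromℤ (ℤ.- a)             ≡⟨ cong fromℤ (ℤ.-1*i≡-i a) ⟨
  fromℤ (ℤ.-1ℤ ℤ.* a)       ≡⟨ fromℤ-homo-* ℤ.-1ℤ a ⟩
  ℚ.- 1ℚ ℚ.* fromℤ a        ≡⟨ ℚ.neg-distribˡ-* 1ℚ (fromℤ a) ⟨
  ℚ.- (1ℚ ℚ.* fromℤ a)      ≡⟨ cong ℚ.-_ (ℚ.*-identityˡ (fromℤ a)) ⟩
  ℚ.- fromℤ a               ∎
  where open ≡-Reasoning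

integral-+ : ∀ {p q} → Integral p → Integral q → Integral (p ℚ.+ q)
integral-+ (a , refl) (b , refl) = a ℤ.+ b , sym (fromℤ-homo-+ a b)

integral-neg : ∀ {p} → Integral p → Integral (ℚ.- p)
integral-neg (a , refl) = ℤ.- a , sym (fromℤ-homo‿- a)

integral-* : ∀ {p q} → Integral p → Integral q → Integral (p ℚ.* q)
integral-* (a , refl) (b , refl) = a ℤ.* b , sym (fromℤ-homo-* a b)

integral-if : ∀ b {p q} → Integral p → Integral q → Integral (if b then p else q)
integral-if true  p q = p
integral-if false p q = q

integral-sum : (f : Fin k → ℚ) → (∀ i → Integral (f i)) → Integral (sum f)
integral-sum {k = ℕ.zero} f f∈ℤ = + 0 , refl
integral-sum {k = suc _}  f f∈ℤ = integral-+ (f∈ℤ zero) (integral-sum (f ∘ suc) (f∈ℤ ∘ suc))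

integral-⟨⟩ : (x : Fin k → ℚ) (X : Subset k) → (∀ i → Integral (x i)) → Integral (x ⟨ X ⟩)
integral-⟨⟩ x X x∈ℤ = integral-sum _ λ i → integral-if (lookup X i) (x∈ℤ i) (+ 0 , refl)

-- Order and sums with values in ℚ ∪ {+∞}

≤⁺-refl : {p : ℚ∞} → p ≤⁺ p
≤⁺-refl {[ p ]} = [ ℚ.≤-refl ]
≤⁺-refl {⊤⁺}    = ⊤⁺ ≤⊤⁺

≤⁺-reflexive : {p q : ℚ∞} → p ≡ q → p ≤⁺ q
≤⁺-reflexive refl = ≤⁺-refl

+∞-mono-≤⁺ : ∀ {p p′ q q′} → p ≤⁺ p′ → q ≤⁺ q′ → p +∞ q ≤⁺ p′ +∞ q′
+∞-mono-≤⁺ [ p≤p′ ]  [ q≤q′ ]  = [ ℚ.+-mono-≤ p≤p′ q≤q′ ]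
+∞-mono-≤⁺ [ p≤p′ ]  (q ≤⊤⁺)   = _ ≤⊤⁺
+∞-mono-≤⁺ (p ≤⊤⁺)   q≤q′      = _ ≤⊤⁺

+∞-interchange : ∀ p q r s → (p +∞ q) +∞ (r +∞ s) ≡ (p +∞ r) +∞ (q +∞ s)
+∞-interchange [ p ] [ q ] [ r ] [ s ] = cong [_] (solve 4 (λ p q r s →
  (p :+ q) :+ (r :+ s) := (p :+ r) :+ (q :+ s)) refl p q r s)
  where open +-*-Solver
+∞-interchange [ p ] [ q ] [ r ] ⊤⁺    = refl
+∞-interchange [ p ] [ q ] ⊤⁺    s     = refl
+∞-interchange [ p ] ⊤⁺    [ r ] s     = refl
+∞-interchange [ p ] ⊤⁺    ⊤⁺    s     = refl
+∞-interchange ⊤⁺    q     r     s     = refl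

sum∞-cong : {f g : Fin k → ℚ∞} → (∀ t → f t ≡ g t) → sum∞ f ≡ sum∞ g
sum∞-cong {k = ℕ.zero} f≡g = refl
sum∞-cong {k = suc _}  f≡g = cong₂ _+∞_ (f≡g zero) (sum∞-cong (f≡g ∘ suc))

sum∞-mono : {f g : Fin k → ℚ∞} → (∀ t → f t ≤⁺ g t) → sum∞ f ≤⁺ sum∞ g
sum∞-mono {k = ℕ.zero} f≤g = ≤⁺-refl
sum∞-mono {k = suc _}  f≤g = +∞-mono-≤⁺ (f≤g zero) (sum∞-mono (f≤g ∘ suc))

sum∞-distrib-+∞ : (f g : Fin k → ℚ∞) → sum∞ (λ t → f t +∞ g t) ≡ sum∞ f +∞ sum∞ g
sum∞-distrib-+∞ {k = ℕ.zero} f g = refl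
sum∞-distrib-+∞ {k = suc _}  f g = trans
  (cong (f zero +∞ g zero +∞_) (sum∞-distrib-+∞ (f ∘ suc) (g ∘ suc)))
  (+∞-interchange (f zero) (g zero) _ _)

sum∞-[] : (f : Fin k → ℚ) → sum∞ (λ t → [ f t ]) ≡ [ sum f ]
sum∞-[] {k = ℕ.zero} f = refl
sum∞-[] {k = suc _}  f = cong ([ f zero ] +∞_) (sum∞-[] (f ∘ suc))

sum∞-zero : {f : Fin k → ℚ∞} → (∀ t → f t ≡ [ 0ℚ ]) → sum∞ f ≡ [ 0ℚ ]
sum∞-zero {k} f≡0 = trans (sum∞-cong f≡0) (trans (sum∞-[] {k} (λ _ → 0ℚ)) (cong [_] (sum-replicate-zero k)))

+∞-identityʳ : ∀ p → p +∞ [ 0ℚ ] ≡ p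
+∞-identityʳ [ p ] = cong [_] (ℚ.+-identityʳ p)
+∞-identityʳ ⊤⁺    = refl

+∞-identityˡ : ∀ p → [ 0ℚ ] +∞ p ≡ p
+∞-identityˡ [ p ] = cong [_] (ℚ.+-identityˡ p)
+∞-identityˡ ⊤⁺    = refl

sum∞-single : (f : Fin k → ℚ∞) (t : Fin k) → (∀ u → u ≢ t → f u ≡ [ 0ℚ ]) → sum∞ f ≡ f t
sum∞-single f zero    f≡0 = trans
  (cong (f zero +∞_) (sum∞-zero λ u → f≡0 (suc u) λ ())) (+∞-identityʳ (f zero))
sum∞-single f (suc t) f≡0 = trans
  (cong₂ _+∞_ (f≡0 zero λ ()) (sum∞-single (f ∘ suc) t λ u u≢t → f≡0 (suc u) (u≢t ∘ Fin.suc-injective)))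
  (+∞-identityˡ (f (suc t)))

+-tightˡ : ∀ {a b c d} → a ℚ.≤ c → b ℚ.≤ d → a ℚ.+ b ≡ c ℚ.+ d → a ≡ c
+-tightˡ {a} {b} {c} {d} a≤c b≤d eq with a ℚ.<? c
... | yes a<c = contradiction eq (ℚ.<⇒≢ (ℚ.+-mono-<-≤ a<c b≤d))
... | no  a≮c = ℚ.≤-antisym a≤c (ℚ.≮⇒≥ a≮c)

+∞-tight : ∀ {a b} {p q : ℚ∞} → [ a ] ≤⁺ p → [ b ] ≤⁺ q → [ a ℚ.+ b ] ≡ p +∞ q →
           [ a ] ≡ p × [ b ] ≡ q
+∞-tight {a} {b} {[ c ]} {[ d ]} [ a≤c ] [ b≤d ] eq with refl ← +-tightˡ a≤c b≤d ([]-injective eq)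
  = refl , cong [_] (∙-cancelˡ a b d ([]-injective eq))

-- A finite total rules out +∞ among the bounds, and slack in one term would survive in the sum.
-- This is what splits a base of a direct sum into bases of its blocks.
sum∞-tight : (x : Fin k → ℚ) (r : Fin k → ℚ∞) → (∀ t → [ x t ] ≤⁺ r t) →
             [ sum x ] ≡ sum∞ r → ∀ t → [ x t ] ≡ r t
sum∞-tight {k = suc _} x r x≤r eq t
  with eq₀ , eqₛ ← +∞-tight (x≤r zero)
         (subst (_≤⁺ sum∞ (r ∘ suc)) (sum∞-[] (x ∘ suc)) (sum∞-mono (x≤r ∘ suc))) eq
  with t
... | zero   = eq₀
... | suc t′ = sum∞-tight (x ∘ suc) (r ∘ suc) (x≤r ∘ suc) eqₛ t′

integral-sum∞ : (r : Fin k → ℚ∞) → (∀ t {q} → r t ≡ [ q ] → Integral q) →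
                ∀ {q} → sum∞ r ≡ [ q ] → Integral q
integral-sum∞ {k = ℕ.zero} r r∈ℤ refl = + 0 , refl
integral-sum∞ {k = suc _}  r r∈ℤ eq
  with r zero in eq₀ | sum∞ (r ∘ suc) in eqₛ
... | [ p ] | [ q ] with refl ← eq = integral-+ (r∈ℤ zero eq₀) (integral-sum∞ (r ∘ suc) (r∈ℤ ∘ suc) eqₛ)

-- Finite sums and vectors on the signed ground set

split-elim : ∀ {p} m {n} (P : Fin (m + n) → Set p) →
             (∀ i → P (i ↑ˡ n)) → (∀ j → P (m ↑ʳ j)) → ∀ a → P a
split-elim m {n} P l r a with splitAt m a | Fin.join-splitAt m n a
... | inj₁ i | refl = l i
... | inj₂ j | refl = r j

sum-++ : ∀ m {n} (f : Fin (m + n) → ℚ) → sum f ≡ sum (f ∘ (_↑ˡ n)) ℚ.+ sum (f ∘ (m ↑ʳ_))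
sum-++ ℕ.zero  f = sym (ℚ.+-identityˡ (sum f))
sum-++ (suc m) f = trans (cong (f zero ℚ.+_) (sum-++ m (f ∘ suc))) (sym (ℚ.+-assoc (f zero) _ _))

sum-neg : (f : Fin k → ℚ) → sum (λ i → ℚ.- f i) ≡ ℚ.- sum f
sum-neg {k = ℕ.zero} f = refl
sum-neg {k = suc _}  f = trans (cong (ℚ.- f zero ℚ.+_) (sum-neg (f ∘ suc))) (sym (ℚ.neg-distrib-+ (f zero) _))

sum-distrib-- : (f g : Fin k → ℚ) → sum (λ i → f i ℚ.- g i) ≡ sum f ℚ.- sum g
sum-distrib-- f g = trans (∑-distrib-+ f (λ i → ℚ.- g i)) (cong (sum f ℚ.+_) (sum-neg g))

sum-mono : {f g : Fin k → ℚ} → (∀ i → f i ℚ.≤ g i) → sum f ℚ.≤ sum g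
sum-mono {k = ℕ.zero} f≤g = ℚ.≤-refl
sum-mono {k = suc _}  f≤g = ℚ.+-mono-≤ (f≤g zero) (sum-mono (f≤g ∘ suc))

sum-unit : (u : Fin k) (f : Fin k → ℚ) → sum (λ i → unit u i ℚ.* f i) ≡ f u
sum-unit {k = suc k} zero f = begin
  1ℚ ℚ.* f zero ℚ.+ sum (λ i → 0ℚ ℚ.* f (suc i))
    ≡⟨ cong₂ ℚ._+_ (ℚ.*-identityˡ (f zero)) (trans (sum-cong-≗ λ i → ℚ.*-zeroˡ (f (suc i))) (sum-replicate-zero k)) ⟩
  f zero ℚ.+ 0ℚ                                   ≡⟨ ℚ.+-identityʳ (f zero) ⟩
  f zero                                          ∎
  where open ≡-Reasoning
sum-unit (suc u) f = begin
  0ℚ ℚ.* f zero ℚ.+ sum (λ i → unit u i ℚ.* f (suc i))  ≡⟨ cong₂ ℚ._+_ (ℚ.*-zeroˡ (f zero)) (sum-unit u (f ∘ suc)) ⟩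
  0ℚ ℚ.+ f (suc u)                                      ≡⟨ ℚ.+-identityˡ (f (suc u)) ⟩
  f (suc u)                                             ∎
  where open ≡-Reasoning

⟨⟩-cong : {x y : Fin k → ℚ} → (∀ i → x i ≡ y i) → ∀ X → x ⟨ X ⟩ ≡ y ⟨ X ⟩
⟨⟩-cong x≡y X = sum-cong-≗ λ i → cong (if lookup X i then_else 0ℚ) (x≡y i)

infix 8 _↾_

-- The summand of `x ⟨ X ⟩`, named so that general lemmas on `sum` can be instantiated with it.
_↾_ : (Fin k → ℚ) → Subset k → Fin k → ℚ
(x ↾ X) i = if lookup X i then x i else 0ℚ

⟨⟩-distrib-- : (x y : Fin k → ℚ) (X : Subset k) → (λ i → x i ℚ.- y i) ⟨ X ⟩ ≡ x ⟨ X ⟩ ℚ.- y ⟨ X ⟩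
⟨⟩-distrib-- x y X = trans (sum-cong-≗ pointwise) (sum-distrib-- (x ↾ X) (y ↾ X))
  where
  pointwise : ∀ i → ((λ i → x i ℚ.- y i) ↾ X) i ≡ (x ↾ X) i ℚ.- (y ↾ X) i
  pointwise i with lookup X i
  ... | true  = refl
  ... | false = refl

⟨⟩-distrib-* : (x : Fin k → ℚ) (c : ℚ) (X : Subset k) → (λ i → x i ℚ.* c) ⟨ X ⟩ ≡ x ⟨ X ⟩ ℚ.* c
⟨⟩-distrib-* x c X = trans (sum-cong-≗ pointwise) (sym (*-distribʳ-sum c (x ↾ X)))
  where
  pointwise : ∀ i → ((λ i → x i ℚ.* c) ↾ X) i ≡ (x ↾ X) i ℚ.* c
  pointwise i with lookup X i
  ... | true  = refl
  ... | false = sym (ℚ.*-zeroˡ c)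

⟨⟩-neg : (x : Fin k → ℚ) (X : Subset k) → (λ i → ℚ.- x i) ⟨ X ⟩ ≡ ℚ.- x ⟨ X ⟩
⟨⟩-neg x X = trans (sum-cong-≗ pointwise) (sum-neg (x ↾ X))
  where
  pointwise : ∀ i → ((λ i → ℚ.- x i) ↾ X) i ≡ ℚ.- (x ↾ X) i
  pointwise i with lookup X i
  ... | true  = refl
  ... | false = refl

_⁺ᵉ _⁻ᵉ : (Fin (n + n) → ℚ) → Fin n → ℚ
_⁺ᵉ {n} x i = x (i ↑ˡ n)
_⁻ᵉ {n} x i = x (n ↑ʳ i)

⟨⟩-++ : (x : Fin (n + n) → ℚ) (Y Z : Subset n) → x ⟨ Y ++ Z ⟩ ≡ (x ⁺ᵉ) ⟨ Y ⟩ ℚ.+ (x ⁻ᵉ) ⟨ Z ⟩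
⟨⟩-++ {n} x Y Z = trans (sum-++ n _) (cong₂ ℚ._+_
  (sum-cong-≗ λ i → cong (if_then x (i ↑ˡ n) else 0ℚ) (Vec.lookup-++ˡ Y Z i))
  (sum-cong-≗ λ i → cong (if_then x (n ↑ʳ i) else 0ℚ) (Vec.lookup-++ʳ Y Z i)))

Ψ-⟨⟩ : (z : Fin n → ℚ) (Y Z : Subset n) → Ψ {n} z ⟨ Y ++ Z ⟩ ≡ z ⟨ Y ⟩ ℚ.- z ⟨ Z ⟩
Ψ-⟨⟩ z Y Z = trans (⟨⟩-++ (Ψ z) Y Z) (cong₂ ℚ._+_
  (⟨⟩-cong (F.lookup-++ˡ z _) Y)
  (trans (⟨⟩-cong (F.lookup-++ʳ z _) Z) (⟨⟩-neg z Z)))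

Ψ-⟨±⟩ : (z : Fin n → ℚ) (U : Subset n) → Ψ {n} z ⟨ U ± ⟩ ≡ 0ℚ
Ψ-⟨±⟩ z U = trans (Ψ-⟨⟩ z U U) (ℚ.+-inverseʳ (z ⟨ U ⟩))

-- Subsets through their characteristic bits

lookup-∩ : (X Y : Subset k) → ∀ i → lookup (X ∩ Y) i ≡ lookup X i ∧ lookup Y i
lookup-∩ X Y i = Vec.lookup-zipWith _∧_ i X Y

lookup-─ : (X Y : Subset k) → ∀ i → lookup (X ─ Y) i ≡ lookup X i ∧ not (lookup Y i)
lookup-─ (true  ∷ X) (true  ∷ Y) zero = refl
lookup-─ (false ∷ X) (true  ∷ Y) zero = refl
lookup-─ (true  ∷ X) (false ∷ Y) zero = refl
lookup-─ (false ∷ X) (false ∷ Y) zero = refl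
lookup-─ (x ∷ X) (y ∷ Y) (suc i) = lookup-─ X Y i

subset-ext : {X Y : Subset k} → (∀ i → lookup X i ≡ lookup Y i) → X ≡ Y
subset-ext {X = X} {Y} eq = begin
  X                   ≡⟨ Vec.tabulate∘lookup X ⟨
  tabulate (lookup X) ≡⟨ Vec.tabulate-cong eq ⟩
  tabulate (lookup Y) ≡⟨ Vec.tabulate∘lookup Y ⟩
  Y                   ∎
  where open ≡-Reasoning

-- The two sides are not definitionally equal for a variable `n`. Reducibility speaks of the left
-- one and submodular flow of the right one, hence the transports along this equation.
⊤±≡⊤ : ∀ n → ⊤ {n} ± ≡ ⊤
⊤±≡⊤ n = subset-ext (split-elim n _
  (λ i → trans (Vec.lookup-++ˡ (⊤ {n}) ⊤ i) (trans (Vec.lookup-replicate i true) (sym (Vec.lookup-replicate (i ↑ˡ n) true))))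
  (λ i → trans (Vec.lookup-++ʳ (⊤ {n}) ⊤ i) (trans (Vec.lookup-replicate i true) (sym (Vec.lookup-replicate (n ↑ʳ i) true)))))

⊆⊤ : (X : Subset k) → X ⊆ ⊤
⊆⊤ X _ = Subset.∈⊤

halves : (X : Subset (n + n)) → ∃[ Y ] ∃[ Z ] X ≡ Y ++ Z
halves {n} X = tabulate (λ i → lookup X (i ↑ˡ n)) , tabulate (λ i → lookup X (n ↑ʳ i)) ,
  subset-ext (split-elim n _
    (λ i → sym (trans (Vec.lookup-++ˡ (tabulate λ i → lookup X (i ↑ˡ n)) _ i) (Vec.lookup∘tabulate _ i)))
    (λ i → sym (trans (Vec.lookup-++ʳ (tabulate λ i → lookup X (i ↑ˡ n)) _ i) (Vec.lookup∘tabulate _ i))))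

disjoint⇒∧≡false : {Y Z : Subset k} → Disjoint Y Z → ∀ i → lookup Y i ∧ lookup Z i ≡ false
disjoint⇒∧≡false {Y = Y} {Z} dis i with lookup Y i in eqY | lookup Z i in eqZ
... | false | _     = refl
... | true  | false = refl
... | true  | true  = contradiction (Vec.lookup⇒[]= i Z eqZ) (dis (Vec.lookup⇒[]= i Y eqY))

─-disjoint : (Y Z : Subset k) → Disjoint (Y ─ Z) (Z ─ Y)
─-disjoint Y Z {i} i∈Y─Z i∈Z─Y = clash (lookup Y i) (lookup Z i)
  (trans (sym (lookup-─ Y Z i)) (Vec.[]=⇒lookup i∈Y─Z))
  (trans (sym (lookup-─ Z Y i)) (Vec.[]=⇒lookup i∈Z─Y))
  where
  clash : ∀ y z → y ∧ not z ≡ true → z ∧ not y ≢ true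
  clash true true  ()
  clash true false _ ()
  clash false _    ()

-- Signed nodes and the contribution of an edge to a cut

node : Sign → Fin n → Fin (n + n)
node {n} Sign.+ i = i ↑ˡ n
node {n} Sign.- i = n ↑ʳ i

unit-injective : (f : Fin k → Fin m) → (∀ {i j} → f i ≡ f j → i ≡ j) → ∀ u v → unit (f u) (f v) ≡ unit u v
unit-injective f inj u v with u Fin.≟ v
... | yes refl rewrite dec-true (f u Fin.≟ f u) refl = refl
... | no u≢v   rewrite dec-false (f u Fin.≟ f v) (u≢v ∘ inj) = refl

unit-distinct : {u v : Fin k} → u ≢ v → unit u v ≡ 0ℚ
unit-distinct {u = u} {v} u≢v rewrite dec-false (u Fin.≟ v) u≢v = refl

↑ˡ≢↑ʳ : (u v : Fin n) → u ↑ˡ n ≢ n ↑ʳ v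
↑ˡ≢↑ʳ {n} u v eq with trans (sym (Fin.splitAt-↑ˡ n u n)) (trans (cong (splitAt n) eq) (Fin.splitAt-↑ʳ n n v))
... | ()

-- Up to the factor ½ this computes Φ of the unit vector at i^s, namely sχᵢ.
unit-node : ∀ s (u v : Fin n) →
            unit (node s u) (v ↑ˡ n) ℚ.- unit (node s u) (n ↑ʳ v) ≡ fromℤ (s ◃ 1) ℚ.* unit u v
unit-node {n} Sign.+ u v
  rewrite unit-injective (_↑ˡ n) (Fin.↑ˡ-injective n _ _) u v
        | unit-distinct (↑ˡ≢↑ʳ u v) = trans (ℚ.+-identityʳ (unit u v)) (sym (ℚ.*-identityˡ (unit u v)))
unit-node {n} Sign.- u v
  rewrite unit-injective (n ↑ʳ_) (Fin.↑ʳ-injective n _ _) u v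
        | unit-distinct (↑ˡ≢↑ʳ v u ∘ sym) = solve 1 (λ x → con 0ℚ :- x := con (fromℤ ℤ.-1ℤ) :* x) refl (unit u v)
  where open +-*-Solver

-- This is why heads carry the opposite sign: the minus sign of a head in the boundary cancels the
-- one found here, and both ends of an edge count positively.
unit-opposite : ∀ s (u v : Fin n) →
                unit (node (Sign.opposite s) u) (v ↑ˡ n) ℚ.- unit (node (Sign.opposite s) u) (n ↑ʳ v)
                  ≡ ℚ.- (fromℤ (s ◃ 1) ℚ.* unit u v)
unit-opposite s u v = trans (unit-node (Sign.opposite s) u v) (trans (cong (ℚ._* unit u v) (flip-sign s))
  (sym (ℚ.neg-distribˡ-* (fromℤ (s ◃ 1)) (unit u v))))
  where
  flip-sign : ∀ s → fromℤ (Sign.opposite s ◃ 1) ≡ ℚ.- fromℤ (s ◃ 1)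
  flip-sign Sign.+ = refl
  flip-sign Sign.- = refl

⟦_⟧ᵇ : Bool → ℚ
⟦ b ⟧ᵇ = if b then 1ℚ else 0ℚ

sign-χ : ∀ s (Y Z : Subset n) i →
         fromℤ (s ◃ 1) ℚ.* χ Y Z i ≡
         ⟦ lookup (Y ++ Z) (node s i) ⟧ᵇ ℚ.- ⟦ lookup (Y ++ Z) (node (Sign.opposite s) i) ⟧ᵇ
sign-χ Sign.+ Y Z i rewrite Vec.lookup-++ˡ Y Z i | Vec.lookup-++ʳ Y Z i = ℚ.*-identityˡ _
sign-χ Sign.- Y Z i rewrite Vec.lookup-++ˡ Y Z i | Vec.lookup-++ʳ Y Z i =
  solve 2 (λ y z → con (fromℤ ℤ.-1ℤ) :* (y :- z) := z :- y) refl ⟦ lookup Y i ⟧ᵇ ⟦ lookup Z i ⟧ᵇ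
  where open +-*-Solver

-- The contributions of an arc to κ and of an edge to κ̂.
arcTerm : Bool → Bool → ℚ → ℚ → ℚ
arcTerm t h lo up = if t ∧ not h then lo else if not t ∧ h then ℚ.- up else 0ℚ

edgeTerm : ℚ → ℚ → ℚ → ℚ
edgeTerm p lo up = if does (0ℚ ℚ.<? p) then p ℚ.* lo else if does (p ℚ.<? 0ℚ) then p ℚ.* up else 0ℚ

edgeTerm≡arcTerms : ∀ u ū v v̄ lo up → u ∧ ū ≡ false → v ∧ v̄ ≡ false →
            edgeTerm ((⟦ u ⟧ᵇ ℚ.- ⟦ ū ⟧ᵇ) ℚ.+ (⟦ v ⟧ᵇ ℚ.- ⟦ v̄ ⟧ᵇ)) lo up ≡ arcTerm u v̄ lo up ℚ.+ arcTerm v ū lo up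
edgeTerm≡arcTerms u ū v v̄ lo up = go u ū v v̄
  where
  open +-*-Solver
  go : ∀ u ū v v̄ → u ∧ ū ≡ false → v ∧ v̄ ≡ false →
       edgeTerm ((⟦ u ⟧ᵇ ℚ.- ⟦ ū ⟧ᵇ) ℚ.+ (⟦ v ⟧ᵇ ℚ.- ⟦ v̄ ⟧ᵇ)) lo up ≡ arcTerm u v̄ lo up ℚ.+ arcTerm v ū lo up
  -- In each case the pairing is a closed rational, so the comparisons in `edgeTerm` compute and
  -- only an identity in `lo` or `up` remains.
  go true  false true  false _ _ = solve 1 (λ x → con (fromℤ (+ 2)) :* x := x :+ x) refl lo
  go true  false false true  _ _ = refl
  go true  false false false _ _ = solve 1 (λ x → con 1ℚ :* x := x :+ con 0ℚ) refl lo
  go false true  true  false _ _ = refl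
  go false true  false true  _ _ = solve 1 (λ x → con (fromℤ (ℤ.- + 2)) :* x := :- x :+ :- x) refl up
  go false true  false false _ _ = solve 1 (λ x → con (fromℤ ℤ.-1ℤ) :* x := con 0ℚ :+ :- x) refl up
  go false false true  false _ _ = solve 1 (λ x → con 1ℚ :* x := con 0ℚ :+ x) refl lo
  go false false false true  _ _ = solve 1 (λ x → con (fromℤ ℤ.-1ℤ) :* x := :- x :+ con 0ℚ) refl up
  go false false false false _ _ = refl

-- Intersecting X with the complement of its mirror image does not decrease κ,
-- since κ is supermodular and invariant under this symmetry.
arcTerms-uncross : ∀ u ū v̄ v {lo up} → lo ℚ.≤ up →
               arcTerm u v̄ lo up ℚ.+ arcTerm v ū lo up ℚ.≤
               arcTerm (u ∧ not ū) (v̄ ∧ not v) lo up ℚ.+ arcTerm (v ∧ not v̄) (ū ∧ not u) lo up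
arcTerms-uncross u ū v̄ v {lo} {up} lo≤up = go u ū v̄ v
  where
  lo-up≤0 : lo ℚ.- up ℚ.≤ 0ℚ
  lo-up≤0 = subst (lo ℚ.- up ℚ.≤_) (ℚ.+-inverseʳ up) (ℚ.+-monoˡ-≤ (ℚ.- up) lo≤up)
  go : ∀ u ū v̄ v → arcTerm u v̄ lo up ℚ.+ arcTerm v ū lo up ℚ.≤
       arcTerm (u ∧ not ū) (v̄ ∧ not v) lo up ℚ.+ arcTerm (v ∧ not v̄) (ū ∧ not u) lo up
  -- One end has both copies in the cut and the other has none: one arc leaves, its mirror image
  -- enters, and `lo - up` is replaced by 0. Only this case and the next use `lo ≤ up`.
  go true  true  false false = lo-up≤0
  go false false true  true  = subst (ℚ._≤ 0ℚ) (ℚ.+-comm lo (ℚ.- up)) lo-up≤0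
  go true  true  true  false = ℚ.≤-reflexive (ℚ.+-comm 0ℚ (ℚ.- up))
  go true  true  false true  = ℚ.≤-reflexive (ℚ.+-comm lo 0ℚ)
  go true  true  true  true  = ℚ.≤-refl
  go true  false true  true  = ℚ.≤-reflexive (ℚ.+-comm 0ℚ lo)
  go false true  true  true  = ℚ.≤-reflexive (ℚ.+-comm (ℚ.- up) 0ℚ)
  go true  false true  false = ℚ.≤-refl
  go true  false false true  = ℚ.≤-refl
  go true  false false false = ℚ.≤-refl
  go false true  true  false = ℚ.≤-refl
  go false true  false true  = ℚ.≤-refl
  go false true  false false = ℚ.≤-refl
  go false false true  false = ℚ.≤-refl
  go false false false true  = ℚ.≤-refl
  go false false false false = ℚ.≤-refl

sum-single : (f : Fin k → ℚ) (t : Fin k) → (∀ u → u ≢ t → f u ≡ 0ℚ) → sum f ≡ f t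
sum-single f t f≡0 = []-injective (trans (sym (sum∞-[] f)) (sum∞-single ([_] ∘ f) t λ u u≢t → cong [_] (f≡0 u u≢t)))

p⊆q⇒p∩q≡p : {p q : Subset k} → p ⊆ q → p ∩ q ≡ p
p⊆q⇒p∩q≡p {p = p} {q} p⊆q = Subset.⊆-antisym (Subset.p∩q⊆p p q) λ i∈p → Subset.x∈p∩q⁺ (i∈p , p⊆q i∈p)

∩-distribʳ-∩ : (p q r : Subset k) → (p ∩ q) ∩ r ≡ (p ∩ r) ∩ (q ∩ r)
∩-distribʳ-∩ p q r = begin
  (p ∩ q) ∩ r         ≡⟨ cong ((p ∩ q) ∩_) (Subset.∩-idem r) ⟨
  (p ∩ q) ∩ (r ∩ r)   ≡⟨ Subset.∩-assoc (p ∩ q) r r ⟨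
  ((p ∩ q) ∩ r) ∩ r   ≡⟨ cong (_∩ r) (Subset.∩-assoc p q r) ⟩
  (p ∩ (q ∩ r)) ∩ r   ≡⟨ cong (λ z → (p ∩ z) ∩ r) (Subset.∩-comm q r) ⟩
  (p ∩ (r ∩ q)) ∩ r   ≡⟨ cong (_∩ r) (Subset.∩-assoc p r q) ⟨
  ((p ∩ r) ∩ q) ∩ r   ≡⟨ Subset.∩-assoc (p ∩ r) q r ⟩
  (p ∩ r) ∩ (q ∩ r)   ∎
  where open ≡-Reasoning

∩-distribʳ-─ : (p q r : Subset k) → (p ─ q) ∩ r ≡ (p ∩ r) ─ (q ∩ r)
∩-distribʳ-─ p q r = subset-ext λ i → begin
  lookup ((p ─ q) ∩ r) i                                                 ≡⟨ lookup-∩ (p ─ q) r i ⟩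
  lookup (p ─ q) i ∧ lookup r i                                          ≡⟨ cong (_∧ lookup r i) (lookup-─ p q i) ⟩
  (lookup p i ∧ not (lookup q i)) ∧ lookup r i                           ≡⟨ bits (lookup p i) (lookup q i) (lookup r i) ⟩
  (lookup p i ∧ lookup r i) ∧ not (lookup q i ∧ lookup r i)
    ≡⟨ cong₂ (λ a b → a ∧ not b) (lookup-∩ p r i) (lookup-∩ q r i) ⟨
  lookup (p ∩ r) i ∧ not (lookup (q ∩ r) i)                              ≡⟨ lookup-─ (p ∩ r) (q ∩ r) i ⟨
  lookup ((p ∩ r) ─ (q ∩ r)) i                                           ∎
  where
  open ≡-Reasoning
  bits : ∀ a b c → (a ∧ not b) ∧ c ≡ (a ∧ c) ∧ not (b ∧ c)
  bits false b     c     = refl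
  bits true  true  true  = refl
  bits true  true  false = refl
  bits true  false true  = refl
  bits true  false false = refl

∩-++ : (Y Z U : Subset n) → (Y ++ Z) ∩ (U ±) ≡ (Y ∩ U) ++ (Z ∩ U)
∩-++ Y Z U = Vec.zipWith-++ _∧_ Y Z U U

-- Direct sums of set functions over a partition

module DirectSum (V : Fin ℓ → Subset k) (r : Fin ℓ → Subset k → ℚ∞) where

  R : Subset k → ℚ∞
  R X = sum∞ (λ t → r t (X ∩ V t))

  private
    term : Subset k → Fin ℓ → ℚ∞
    term X t = r t (X ∩ V t)

  -- Intersecting with a block preserves unions and intersections, so the inequality holds term by
  -- term.
  submodular : (∀ t → SubmodularOn (V t) (r t)) → SubmodularOn ⊤ R
  submodular sub =
    sum∞-zero (λ t → trans (cong (r t) (Subset.∩-zeroˡ (V t))) (proj₁ (sub t))) ,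
    λ X X′ _ _ → subst₂ _≤⁺_ (sum∞-distrib-+∞ (term (X ∪ X′)) (term (X ∩ X′))) (sum∞-distrib-+∞ (term X) (term X′)) (sum∞-mono λ t →
      subst (_≤⁺ r t (X ∩ V t) +∞ r t (X′ ∩ V t))
        (sym (cong₂ (λ A B → r t A +∞ r t B) (Subset.∩-distribʳ-∪ (V t) X X′) (∩-distribʳ-∩ X X′ (V t))))
        (proj₂ (sub t) _ _ (Subset.p∩q⊆q X (V t)) (Subset.p∩q⊆q X′ (V t))))

  integral : (∀ t → IntegralOn (V t) (r t)) → IntegralOn ⊤ R
  integral r∈ℤ X _ = integral-sum∞ _ λ t → r∈ℤ t _ (Subset.p∩q⊆q X (V t))

  module _ (partition : IsPartition V) where

    block-unique : ∀ {i t u} → i ∈ V t → i ∈ V u → t ≡ u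
    block-unique {i} i∈Vt i∈Vu with _ , _ , unique ← partition i = trans (sym (unique i∈Vt)) (unique i∈Vu)

    ⟨⟩-partition : (x : Fin k → ℚ) (X : Subset k) → x ⟨ X ⟩ ≡ sum (λ t → x ⟨ X ∩ V t ⟩)
    ⟨⟩-partition x X = sym (trans (∑-comm (λ t i → (x ↾ (X ∩ V t)) i)) (sum-cong-≗ column))
      where
      column : ∀ i → sum (λ t → (x ↾ (X ∩ V t)) i) ≡ (x ↾ X) i
      column i with t , i∈Vt , unique ← partition i = trans
        (sum-single (λ u → (x ↾ (X ∩ V u)) i) t outside-block)
        (cong (if_then x i else 0ℚ) inside-block)
        where
        inside-block : lookup (X ∩ V t) i ≡ lookup X i
        inside-block rewrite lookup-∩ X (V t) i | Vec.[]=⇒lookup i∈Vt with lookup X i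
        ... | true  = refl
        ... | false = refl
        outside-block : ∀ u → u ≢ t → (x ↾ (X ∩ V u)) i ≡ 0ℚ
        outside-block u u≢t with lookup (X ∩ V u) i in eq
        ... | false = refl
        ... | true  = contradiction
          (sym (unique (Subset.p∩q⊆q X (V u) (Vec.lookup⇒[]= i (X ∩ V u) eq)))) u≢t

    restrict : (∀ t → r t ⊥ ≡ [ 0ℚ ]) → ∀ t X → X ⊆ V t → R X ≡ r t X
    restrict r⊥≡0 t X X⊆Vt = trans
      (sum∞-single _ t λ u u≢t → trans (cong (r u) (Subset.Empty-unique λ (i , i∈) →
        u≢t (block-unique (Subset.p∩q⊆q X (V u) i∈) (X⊆Vt (Subset.p∩q⊆p X (V u) i∈))))) (r⊥≡0 u))
      (cong (r t) (p⊆q⇒p∩q≡p X⊆Vt))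

    -- On subsets of a block `R` agrees with `r t`, which gives the inequalities. The block totals
    -- are thus bounded by the `r t (V t)`, and these bounds add up to the equality at the ground
    -- set, so each is tight.
    base⇒bases : (∀ t → r t ⊥ ≡ [ 0ℚ ]) → ∀ {x} → Base ⊤ R x → ∀ t → Base (V t) (r t) x
    base⇒bases r⊥≡0 {x} (x⊤≡R⊤ , x≤R) t = tight , bound
      where
      bound : ∀ {u} X → X ⊆ V u → [ x ⟨ X ⟩ ] ≤⁺ r u X
      bound {u} X X⊆Vu = subst ([ x ⟨ X ⟩ ] ≤⁺_) (restrict r⊥≡0 u X X⊆Vu) (x≤R X (⊆⊤ X))
      tight : [ x ⟨ V t ⟩ ] ≡ r t (V t)
      tight = subst (λ X → [ x ⟨ X ⟩ ] ≡ r t X) (Subset.∩-identityˡ (V t))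
        (sum∞-tight (λ u → x ⟨ ⊤ ∩ V u ⟩) (λ u → r u (⊤ ∩ V u))
          (λ u → bound (⊤ ∩ V u) (Subset.p∩q⊆q ⊤ (V u)))
          (trans (cong [_] (sym (⟨⟩-partition x ⊤))) x⊤≡R⊤) t)

    bases⇒base : ∀ {x} → (∀ t → Base (V t) (r t) x) → Base ⊤ R x
    bases⇒base {x} bases =
      trans (split ⊤) (sum∞-cong λ t →
        subst (λ X → [ x ⟨ X ⟩ ] ≡ r t X) (sym (Subset.∩-identityˡ (V t))) (proj₁ (bases t))) ,
      λ X _ → subst (_≤⁺ R X) (sym (split X)) (sum∞-mono λ t →
        proj₂ (bases t) (X ∩ V t) (Subset.p∩q⊆q X (V t)))
      where
      split : ∀ X → [ x ⟨ X ⟩ ] ≡ sum∞ (λ t → [ x ⟨ X ∩ V t ⟩ ])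
      split X = trans (cong [_] (⟨⟩-partition x X)) (sym (sum∞-[] λ t → x ⟨ X ∩ V t ⟩))

-- Reducibility

∈-++ˡ : ∀ {i} (Y Z : Subset n) → i ∈ Y → (i ↑ˡ n) ∈ Y ++ Z
∈-++ˡ {i = i} Y Z i∈Y = Vec.lookup⇒[]= _ _ (trans (Vec.lookup-++ˡ Y Z i) (Vec.[]=⇒lookup i∈Y))

∈-++ʳ : ∀ {i} (Y Z : Subset n) → i ∈ Z → (n ↑ʳ i) ∈ Y ++ Z
∈-++ʳ {i = i} Y Z i∈Z = Vec.lookup⇒[]= _ _ (trans (Vec.lookup-++ʳ Y Z i) (Vec.[]=⇒lookup i∈Z))

∈-++ˡ⁻ : ∀ {i} (Y Z : Subset n) → (i ↑ˡ n) ∈ Y ++ Z → i ∈ Y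
∈-++ˡ⁻ {i = i} Y Z i∈ = Vec.lookup⇒[]= _ _ (trans (sym (Vec.lookup-++ˡ Y Z i)) (Vec.[]=⇒lookup i∈))

∈-++ʳ⁻ : ∀ {i} (Y Z : Subset n) → (n ↑ʳ i) ∈ Y ++ Z → i ∈ Z
∈-++ʳ⁻ {i = i} Y Z i∈ = Vec.lookup⇒[]= _ _ (trans (sym (Vec.lookup-++ʳ Y Z i)) (Vec.[]=⇒lookup i∈))

±-partition : (U : Fin ℓ → Subset n) → IsPartition U → IsPartition (λ t → U t ±)
±-partition {n = n} U partition = split-elim n _
  (λ i → let t , i∈Ut , unique = partition i in
    t , ∈-++ˡ (U t) (U t) i∈Ut , λ {u} i∈ → unique (∈-++ˡ⁻ (U u) (U u) i∈))
  (λ i → let t , i∈Ut , unique = partition i in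
    t , ∈-++ʳ (U t) (U t) i∈Ut , λ {u} i∈ → unique (∈-++ʳ⁻ (U u) (U u) i∈))

module _ {U : Subset n} {β} {ρ} (reducible : ReducibleOn U β ρ) where
  open ReducibleOn reducible

  -- `Ψ (Φ x)` is a base as well, and it is antisymmetric, so its total vanishes; all bases share
  -- the total `ρ (U ±)`.
  ρ-total : ∀ {x} → Base (U ±) ρ x → ρ (U ±) ≡ [ 0ℚ ]
  ρ-total {x} x∈B = trans (sym (proj₁ (ΨΦ-closed x x∈B))) (cong [_] (Ψ-⟨±⟩ (Φ x) U))

  base-total : ∀ {x} → Base (U ±) ρ x → x ⟨ U ± ⟩ ≡ 0ℚ
  base-total x∈B = []-injective (trans (proj₁ x∈B) (ρ-total x∈B))

  base⇒Φ-integral : ∀ {x} → Base (U ±) ρ x → (∀ i → Integral (x i)) → Integral (Φ {n} x ⟨ U ⟩)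
  base⇒Φ-integral {x} x∈B x∈ℤ = subst Integral (sym Φ≡) (integral-⟨⟩ (x ⁺ᵉ) U (λ i → x∈ℤ (i ↑ˡ n)))
    where
    open ≡-Reasoning
    p q : ℚ
    p = (x ⁺ᵉ) ⟨ U ⟩
    q = (x ⁻ᵉ) ⟨ U ⟩
    Φ≡ : Φ {n} x ⟨ U ⟩ ≡ p
    Φ≡ = begin
      Φ {n} x ⟨ U ⟩                             ≡⟨ ⟨⟩-distrib-* (λ i → x (i ↑ˡ n) ℚ.- x (n ↑ʳ i)) ½ U ⟩
      (λ i → x (i ↑ˡ n) ℚ.- x (n ↑ʳ i)) ⟨ U ⟩ ℚ.* ½  ≡⟨ cong (ℚ._* ½) (⟨⟩-distrib-- (x ⁺ᵉ) (x ⁻ᵉ) U) ⟩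
      -- Writing p - q as 2p - (p + q) isolates the total p + q of `x`, which is 0.
      (p ℚ.- q) ℚ.* ½                           ≡⟨ solve 2 (λ p q → (p :- q) :* con ½ := p :- (p :+ q) :* con ½) refl p q ⟩
      p ℚ.- (p ℚ.+ q) ℚ.* ½                     ≡⟨ cong (λ z → p ℚ.- z ℚ.* ½) (trans (sym (⟨⟩-++ x U U)) (base-total x∈B)) ⟩
      p ℚ.- 0ℚ                                  ≡⟨ ℚ.+-identityʳ p ⟩
      p                                         ∎
      where open +-*-Solver

-- Every condition is checked block by block, as cutting with `U t ±` commutes with removing pairs
-- and with forming Y⁺ ∪ Z⁻. `Base G ρ x` constrains only the coordinates in `G`, so the full
-- vectors `x` and `Ψ (Φ x)` serve for each block without being restricted.
⨁-reducible : {U : Fin ℓ → Subset n} {β : Subset n → Subset n → ℚ∞}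
              {βs : Fin ℓ → Subset n → Subset n → ℚ∞} {ρs : Fin ℓ → Subset (n + n) → ℚ∞} →
              IsPartition U → Separable U β βs → (∀ t → ReducibleOn (U t) (βs t) (ρs t)) →
              ReducibleOn ⊤ β (⨁ U ρs)
⨁-reducible {n = n} {U} {β} {βs} {ρs} partition separable reducible = record
  { submodular = subst (λ G → SubmodularOn G (⨁ U ρs)) (sym (⊤±≡⊤ n))
      (DirectSum.submodular (λ t → U t ±) ρs λ t → R.submodular t)
  ; t-monotone = λ Y Z _ _ → sum∞-mono λ t →
      subst₂ (λ A B → ρs t A ≤⁺ ρs t B)
        (sym (trans (∩-++ (Y ─ Z) (Z ─ Y) (U t)) (cong₂ _++_ (∩-distribʳ-─ Y Z (U t)) (∩-distribʳ-─ Z Y (U t)))))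
        (sym (∩-++ Y Z (U t)))
        (R.t-monotone t (Y ∩ U t) (Z ∩ U t) (Subset.p∩q⊆q Y (U t)) (Subset.p∩q⊆q Z (U t)))
  ; ΨΦ-closed  = λ x x∈B → subst (λ G → Base G (⨁ U ρs) (Ψ (Φ {n} x))) (sym (⊤±≡⊤ n))
      (bases⇒base partition± λ t → R.ΨΦ-closed t x
        (base⇒bases partition± (λ t → proj₁ (R.submodular t)) (subst (λ G → Base G (⨁ U ρs) x) (⊤±≡⊤ n) x∈B) t))
  ; represents = λ Y Z _ _ dis → trans (separable Y Z dis) (sum∞-cong λ t →
      trans (R.represents t _ _ (Subset.p∩q⊆q Y (U t)) (Subset.p∩q⊆q Z (U t))
              (λ i∈Y i∈Z → dis (Subset.p∩q⊆p Y (U t) i∈Y) (Subset.p∩q⊆p Z (U t) i∈Z)))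
            (cong (ρs t) (sym (∩-++ Y Z (U t)))))
  }
  where
  module R t = ReducibleOn (reducible t)
  open DirectSum (λ t → U t ±) ρs
  partition± : IsPartition (λ t → U t ±)
  partition± = ±-partition U partition

-- The skew-symmetric submodular flow instance

≤⁺-<⁺-≤-trans : ∀ {p q : ℚ∞} {a b} → p ≤⁺ q → q <⁺ [ a ] → a ℚ.≤ b → p <⁺ [ b ]
≤⁺-<⁺-≤-trans [ p≤q ] [ q<a ] a≤b = [ ℚ.<-≤-trans (ℚ.≤-<-trans p≤q q<a) a≤b ]

halve : (Fin (m + m) → ℚ) → Fin m → ℚ
halve {m} φ e = (φ (e ↑ˡ m) ℚ.+ φ (m ↑ʳ e)) ℚ.* ½

double-½ : ∀ p → (p ℚ.+ p) ℚ.* ½ ≡ p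
double-½ = solve 1 (λ p → (p :+ p) :* con ½ := p) refl
  where open +-*-Solver

module Skew {n m} (I : BisubmodularFlow n m) {ρ : Subset (n + n) → ℚ∞}
            (reducible : ReducibleOn ⊤ (BisubmodularFlow.β I) ρ)
            (a-base : ∃[ x ] Base ⊤ ρ x) where
  open BisubmodularFlow I
  open ReducibleOn reducible

  private
    ⟨±⟩ : ∀ {x} → Base ⊤ ρ x → Base (⊤ {n} ±) ρ x
    ⟨±⟩ {x} = subst (λ G → Base G ρ x) (sym (⊤±≡⊤ n))

    ∼_ : Sign → Sign
    ∼_ = Sign.opposite

  -- Reversing an arc and negating both of its signs exchanges the arcs `e` and `m + e`. A
  -- self-loop, whose two signs agree, yields two parallel arcs.
  tails heads : Fin (m + m) → Fin (n + n)
  tails = (λ e → node (sign₁ e) (end₁ e))       F.++ (λ e → node (sign₂ e) (end₂ e))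
  heads = (λ e → node (∼ sign₂ e) (end₂ e)) F.++ (λ e → node (∼ sign₁ e) (end₁ e))

  tails-ˡ : ∀ e → tails (e ↑ˡ m) ≡ node (sign₁ e) (end₁ e)
  tails-ˡ = F.lookup-++ˡ (λ e → node (sign₁ e) (end₁ e)) _

  tails-ʳ : ∀ e → tails (m ↑ʳ e) ≡ node (sign₂ e) (end₂ e)
  tails-ʳ = F.lookup-++ʳ (λ e → node (sign₁ e) (end₁ e)) _

  heads-ˡ : ∀ e → heads (e ↑ˡ m) ≡ node (∼ sign₂ e) (end₂ e)
  heads-ˡ = F.lookup-++ˡ (λ e → node (∼ sign₂ e) (end₂ e)) _

  heads-ʳ : ∀ e → heads (m ↑ʳ e) ≡ node (∼ sign₁ e) (end₁ e)
  heads-ʳ = F.lookup-++ʳ (λ e → node (∼ sign₂ e) (end₂ e)) _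

  lowers′ uppers′ : Fin (m + m) → ℚ
  lowers′ = lower F.++ lower
  uppers′ = upper F.++ upper

  skew : SubmodularFlow (n + n) (m + m)
  skew = record
    { tail        = tails
    ; head        = heads
    ; lower       = lowers′
    ; upper       = uppers′
    ; lower≤upper = split-elim m _
        (λ e → subst₂ ℚ._≤_ (sym (F.lookup-++ˡ lower lower e)) (sym (F.lookup-++ˡ upper upper e)) (lower≤upper e))
        (λ e → subst₂ ℚ._≤_ (sym (F.lookup-++ʳ lower lower e)) (sym (F.lookup-++ʳ upper upper e)) (lower≤upper e))
    ; ρ           = ρ
    ; submodular  = subst (λ G → SubmodularOn G ρ) (⊤±≡⊤ n) submodular
    -- The only field that needs the existence of a base.
    ; ρ⊤≡0        = trans (cong ρ (sym (⊤±≡⊤ n))) (ρ-total reducible (⟨±⟩ (proj₂ a-base)))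
    }

  module S = SubmodularFlow skew

  integralData : IntegralCapacities → IntegralOn (⊤ {n} ±) ρ → S.IntegralData
  integralData caps ρ∈ℤ =
    split-elim m _
      (λ e → subst Integral (sym (F.lookup-++ˡ lower lower e)) (proj₁ (caps e)) ,
             subst Integral (sym (F.lookup-++ˡ upper upper e)) (proj₂ (caps e)))
      (λ e → subst Integral (sym (F.lookup-++ʳ lower lower e)) (proj₁ (caps e)) ,
             subst Integral (sym (F.lookup-++ʳ upper upper e)) (proj₂ (caps e))) ,
    subst (λ G → IntegralOn G ρ) (⊤±≡⊤ n) ρ∈ℤ

  boundary-integral : ∀ φ → (∀ a → Integral (φ a)) → ∀ v → Integral (S.boundary φ v)
  boundary-integral φ φ∈ℤ v = integral-sum _ λ a →
    integral-* (φ∈ℤ a) (integral-+ (unit-integral (tails a) v) (integral-neg (unit-integral (heads a) v)))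
    where
    unit-integral : ∀ {k} (u v : Fin k) → Integral (unit u v)
    unit-integral u v = integral-if (does (u Fin.≟ v)) (+ 1 , refl) (+ 0 , refl)

  -- Φ sends the boundary of a unit of flow to ½ ∂e on either of the two arcs of e. Hence their
  -- flows enter Φ(∂φ) only through the sum, and half of the sum is `halve φ e`.
  ∇-halve : ∀ φ i → ∇ (halve φ) i ≡ Φ (S.boundary φ) i
  ∇-halve φ i = sym (begin
    (sum (flow (i ↑ˡ n)) ℚ.- sum (flow (n ↑ʳ i))) ℚ.* ½   ≡⟨ cong (ℚ._* ½) (sum-distrib-- (flow (i ↑ˡ n)) (flow (n ↑ʳ i))) ⟨
    sum diff ℚ.* ½                                        ≡⟨ cong (ℚ._* ½) (sum-++ m diff) ⟩
    (sum (diff ∘ (_↑ˡ m)) ℚ.+ sum (diff ∘ (m ↑ʳ_))) ℚ.* ½ ≡⟨ cong (ℚ._* ½) (∑-distrib-+ (diff ∘ (_↑ˡ m)) (diff ∘ (m ↑ʳ_))) ⟨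
    sum (λ e → diff (e ↑ˡ m) ℚ.+ diff (m ↑ʳ e)) ℚ.* ½     ≡⟨ *-distribʳ-sum ½ (λ e → diff (e ↑ˡ m) ℚ.+ diff (m ↑ʳ e)) ⟩
    sum (λ e → (diff (e ↑ˡ m) ℚ.+ diff (m ↑ʳ e)) ℚ.* ½)   ≡⟨ sum-cong-≗ contribution ⟩
    sum (λ e → halve φ e ℚ.* ∂ e i)                       ∎)
    where
    open ≡-Reasoning
    flow : Fin (n + n) → Fin (m + m) → ℚ
    flow v a = φ a ℚ.* (unit (tails a) v ℚ.- unit (heads a) v)
    diff : Fin (m + m) → ℚ
    diff a = flow (i ↑ˡ n) a ℚ.- flow (n ↑ʳ i) a
    open +-*-Solver
    -- Abstracted over tail and head so that `tails-ˡ` and its companions can be applied by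
    -- congruence.
    divergence : Fin (n + n) → Fin (n + n) → ℚ → ℚ
    divergence t h f = f ℚ.* (unit t (i ↑ˡ n) ℚ.- unit h (i ↑ˡ n)) ℚ.- f ℚ.* (unit t (n ↑ʳ i) ℚ.- unit h (n ↑ʳ i))
    divergence-of : ∀ t h f {p q} → unit t (i ↑ˡ n) ℚ.- unit t (n ↑ʳ i) ≡ p →
                    unit h (i ↑ˡ n) ℚ.- unit h (n ↑ʳ i) ≡ ℚ.- q → divergence t h f ≡ f ℚ.* (p ℚ.+ q)
    divergence-of t h f {p} {q} eqₜ eqₕ = begin
      divergence t h f
        ≡⟨ solve 5 (λ f a b c d → f :* (a :- b) :- f :* (c :- d) := f :* ((a :- c) :- (b :- d))) refl
             f (unit t (i ↑ˡ n)) (unit h (i ↑ˡ n)) (unit t (n ↑ʳ i)) (unit h (n ↑ʳ i)) ⟩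
      f ℚ.* ((unit t (i ↑ˡ n) ℚ.- unit t (n ↑ʳ i)) ℚ.- (unit h (i ↑ˡ n) ℚ.- unit h (n ↑ʳ i)))
        ≡⟨ cong₂ (λ x y → f ℚ.* (x ℚ.- y)) eqₜ eqₕ ⟩
      f ℚ.* (p ℚ.- ℚ.- q)
        ≡⟨ solve 3 (λ f p q → f :* (p :- :- q) := f :* (p :+ q)) refl f p q ⟩
      f ℚ.* (p ℚ.+ q) ∎
    contribution : ∀ e → (diff (e ↑ˡ m) ℚ.+ diff (m ↑ʳ e)) ℚ.* ½ ≡ halve φ e ℚ.* ∂ e i
    contribution e = begin
      (diff (e ↑ˡ m) ℚ.+ diff (m ↑ʳ e)) ℚ.* ½
        ≡⟨ cong (ℚ._* ½) (cong₂ ℚ._+_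
             (cong₂ (λ t h → divergence t h (φ (e ↑ˡ m))) (tails-ˡ e) (heads-ˡ e))
             (cong₂ (λ t h → divergence t h (φ (m ↑ʳ e))) (tails-ʳ e) (heads-ʳ e))) ⟩
      (divergence (node (sign₁ e) (end₁ e)) (node (∼ sign₂ e) (end₂ e)) (φ (e ↑ˡ m)) ℚ.+
       divergence (node (sign₂ e) (end₂ e)) (node (∼ sign₁ e) (end₁ e)) (φ (m ↑ʳ e))) ℚ.* ½
        ≡⟨ cong (ℚ._* ½) (cong₂ ℚ._+_
             (divergence-of (node (sign₁ e) (end₁ e)) (node (∼ sign₂ e) (end₂ e)) (φ (e ↑ˡ m))
               (unit-node (sign₁ e) (end₁ e) i) (unit-opposite (sign₂ e) (end₂ e) i))
             (divergence-of (node (sign₂ e) (end₂ e)) (node (∼ sign₁ e) (end₁ e)) (φ (m ↑ʳ e))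
               (unit-node (sign₂ e) (end₂ e) i) (unit-opposite (sign₁ e) (end₁ e) i))) ⟩
      (φ (e ↑ˡ m) ℚ.* (p ℚ.+ q) ℚ.+ φ (m ↑ʳ e) ℚ.* (q ℚ.+ p)) ℚ.* ½
        ≡⟨ solve 4 (λ f g p q → (f :* (p :+ q) :+ g :* (q :+ p)) :* con ½ := (f :+ g) :* con ½ :* (p :+ q)) refl
             (φ (e ↑ˡ m)) (φ (m ↑ʳ e)) p q ⟩
      halve φ e ℚ.* ∂ e i
        ∎
      where
      p q : ℚ
      p = fromℤ (sign₁ e ◃ 1) ℚ.* unit (end₁ e) i
      q = fromℤ (sign₂ e ◃ 1) ℚ.* unit (end₂ e) i

  -- A mean stays between common capacities. The base inequality of `Ψ z` at Y⁺ ∪ Z⁻ is literally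
  -- z(Y) - z(Z) ≤ β(Y,Z).
  halve-feasible : ∀ φ → S.Feasible φ → Feasible (halve φ)
  halve-feasible φ (within , bd∈B) = capacities , bounds
    where
    ½-mono : ∀ {p q} → p ℚ.≤ q → p ℚ.* ½ ℚ.≤ q ℚ.* ½
    ½-mono = ℚ.*-monoʳ-≤-nonNeg ½
    capacities : ∀ e → lower e ℚ.≤ halve φ e × halve φ e ℚ.≤ upper e
    capacities e =
      subst (ℚ._≤ halve φ e) (double-½ (lower e)) (½-mono (ℚ.+-mono-≤
        (subst (ℚ._≤ φ (e ↑ˡ m)) (F.lookup-++ˡ lower lower e) (proj₁ (within (e ↑ˡ m))))
        (subst (ℚ._≤ φ (m ↑ʳ e)) (F.lookup-++ʳ lower lower e) (proj₁ (within (m ↑ʳ e)))))) ,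
      subst (halve φ e ℚ.≤_) (double-½ (upper e)) (½-mono (ℚ.+-mono-≤
        (subst (φ (e ↑ˡ m) ℚ.≤_) (F.lookup-++ˡ upper upper e) (proj₂ (within (e ↑ˡ m))))
        (subst (φ (m ↑ʳ e) ℚ.≤_) (F.lookup-++ʳ upper upper e) (proj₂ (within (m ↑ʳ e))))))
    z : Fin n → ℚ
    z = Φ {n} (S.boundary φ)
    bounds : ∀ Y Z → Disjoint Y Z → [ ∇ (halve φ) ⟨ Y ⟩ ℚ.- ∇ (halve φ) ⟨ Z ⟩ ] ≤⁺ β Y Z
    bounds Y Z dis = subst₂ _≤⁺_
      (cong [_] (trans (Ψ-⟨⟩ z Y Z) (sym (cong₂ ℚ._-_ (⟨⟩-cong (∇-halve φ) Y) (⟨⟩-cong (∇-halve φ) Z)))))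
      (sym (represents Y Z (⊆⊤ Y) (⊆⊤ Z) dis))
      (proj₂ (ΨΦ-closed (S.boundary φ) (⟨±⟩ {S.boundary φ} bd∈B)) (Y ++ Z) (subst (Y ++ Z ⊆_) (sym (⊤±≡⊤ n)) (⊆⊤ (Y ++ Z))))

  -- The cut enters through its bits at signed nodes, the form in which removing mirror pairs is a
  -- Boolean formula.
  pairTerm : (Sign → Fin n → Bool) → Fin m → ℚ
  pairTerm bit e =
    arcTerm (bit (sign₁ e) (end₁ e)) (bit (∼ sign₂ e) (end₂ e)) (lower e) (upper e) ℚ.+
    arcTerm (bit (sign₂ e) (end₂ e)) (bit (∼ sign₁ e) (end₁ e)) (lower e) (upper e)

  κ-pairs : ∀ X → S.κ X ≡ sum (pairTerm (λ s i → lookup X (node s i)))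
  κ-pairs X = trans (sum-++ m term) (trans (sym (∑-distrib-+ (term ∘ (_↑ˡ m)) (term ∘ (m ↑ʳ_))))
    (sum-cong-≗ λ e → cong₂ ℚ._+_
      (arcTerm-cong (tails-ˡ e) (heads-ˡ e) (F.lookup-++ˡ lower lower e) (F.lookup-++ˡ upper upper e))
      (arcTerm-cong (tails-ʳ e) (heads-ʳ e) (F.lookup-++ʳ lower lower e) (F.lookup-++ʳ upper upper e))))
    where
    term : Fin (m + m) → ℚ
    term a = arcTerm (lookup X (tails a)) (lookup X (heads a)) (lowers′ a) (uppers′ a)
    arcTerm-cong : ∀ {t t′ h h′ lo lo′ up up′} → t ≡ t′ → h ≡ h′ → lo ≡ lo′ → up ≡ up′ →
                   arcTerm (lookup X t) (lookup X h) lo up ≡ arcTerm (lookup X t′) (lookup X h′) lo′ up′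
    arcTerm-cong refl refl refl refl = refl

  κ̂≡κ : ∀ Y Z → Disjoint Y Z → κ̂ Y Z ≡ S.κ (Y ++ Z)
  κ̂≡κ Y Z dis = trans (sum-cong-≗ pointwise) (sym (κ-pairs (Y ++ Z)))
    where
    bit : Sign → Fin n → Bool
    bit s i = lookup (Y ++ Z) (node s i)
    exclusive : ∀ s i → bit s i ∧ bit (∼ s) i ≡ false
    exclusive Sign.+ i rewrite Vec.lookup-++ˡ Y Z i | Vec.lookup-++ʳ Y Z i = disjoint⇒∧≡false dis i
    exclusive Sign.- i rewrite Vec.lookup-++ˡ Y Z i | Vec.lookup-++ʳ Y Z i =
      disjoint⇒∧≡false (λ i∈Z i∈Y → dis i∈Y i∈Z) i
    pairing : ∀ e → sum (λ i → ∂ e i ℚ.* χ Y Z i) ≡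
      (⟦ bit (sign₁ e) (end₁ e) ⟧ᵇ ℚ.- ⟦ bit (∼ sign₁ e) (end₁ e) ⟧ᵇ) ℚ.+
      (⟦ bit (sign₂ e) (end₂ e) ⟧ᵇ ℚ.- ⟦ bit (∼ sign₂ e) (end₂ e) ⟧ᵇ)
    pairing e = begin
      sum (λ i → ∂ e i ℚ.* χ Y Z i)
        ≡⟨ sum-cong-≗ (λ i → solve 5 (λ s u t v x → (s :* u :+ t :* v) :* x := s :* (u :* x) :+ t :* (v :* x)) refl
             (sgn (sign₁ e)) (unit (end₁ e) i) (sgn (sign₂ e)) (unit (end₂ e) i) (χ Y Z i)) ⟩
      sum (λ i → sgn (sign₁ e) ℚ.* (unit (end₁ e) i ℚ.* χ Y Z i) ℚ.+ sgn (sign₂ e) ℚ.* (unit (end₂ e) i ℚ.* χ Y Z i))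
        ≡⟨ ∑-distrib-+
             (λ i → sgn (sign₁ e) ℚ.* (unit (end₁ e) i ℚ.* χ Y Z i))
             (λ i → sgn (sign₂ e) ℚ.* (unit (end₂ e) i ℚ.* χ Y Z i)) ⟩
      sum (λ i → sgn (sign₁ e) ℚ.* (unit (end₁ e) i ℚ.* χ Y Z i)) ℚ.+
      sum (λ i → sgn (sign₂ e) ℚ.* (unit (end₂ e) i ℚ.* χ Y Z i))
        ≡⟨ cong₂ ℚ._+_ (end (sign₁ e) (end₁ e)) (end (sign₂ e) (end₂ e)) ⟩
      _ ∎
      where
      open ≡-Reasoning
      open +-*-Solver
      sgn : Sign → ℚ
      sgn s = fromℤ (s ◃ 1)
      end : ∀ s u → sum (λ i → sgn s ℚ.* (unit u i ℚ.* χ Y Z i)) ≡ ⟦ bit s u ⟧ᵇ ℚ.- ⟦ bit (∼ s) u ⟧ᵇ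
      end s u = trans (sym (*-distribˡ-sum (sgn s) (λ i → unit u i ℚ.* χ Y Z i)))
                (trans (cong (sgn s ℚ.*_) (sum-unit u (χ Y Z))) (sign-χ s Y Z u))
    pointwise : ∀ e → edgeTerm (sum (λ i → ∂ e i ℚ.* χ Y Z i)) (lower e) (upper e) ≡ pairTerm bit e
    pointwise e = trans (cong (λ p → edgeTerm p (lower e) (upper e)) (pairing e))
      (edgeTerm≡arcTerms (bit (sign₁ e) (end₁ e)) (bit (∼ sign₁ e) (end₁ e))
        (bit (sign₂ e) (end₂ e)) (bit (∼ sign₂ e) (end₂ e)) (lower e) (upper e)
        (exclusive (sign₁ e) (end₁ e)) (exclusive (sign₂ e) (end₂ e)))

  κ-uncross : ∀ Y Z → S.κ (Y ++ Z) ℚ.≤ S.κ ((Y ─ Z) ++ (Z ─ Y))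
  κ-uncross Y Z = subst₂ ℚ._≤_ (sym (κ-pairs (Y ++ Z))) (sym (κ-pairs ((Y ─ Z) ++ (Z ─ Y)))) (sum-mono pointwise)
    where
    bit bit′ : Sign → Fin n → Bool
    bit  s i = lookup (Y ++ Z) (node s i)
    bit′ s i = lookup ((Y ─ Z) ++ (Z ─ Y)) (node s i)
    unpaired : ∀ s i → bit′ s i ≡ bit s i ∧ not (bit (∼ s) i)
    unpaired Sign.+ i rewrite Vec.lookup-++ˡ Y Z i | Vec.lookup-++ʳ Y Z i = trans (Vec.lookup-++ˡ (Y ─ Z) (Z ─ Y) i) (lookup-─ Y Z i)
    unpaired Sign.- i rewrite Vec.lookup-++ˡ Y Z i | Vec.lookup-++ʳ Y Z i = trans (Vec.lookup-++ʳ (Y ─ Z) (Z ─ Y) i) (lookup-─ Z Y i)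
    -- `unpaired (∼ s)` would mention `∼ (∼ s)`, which reduces to `s` only for a concrete sign.
    unpaired-opposite : ∀ s i → bit′ (∼ s) i ≡ bit (∼ s) i ∧ not (bit s i)
    unpaired-opposite Sign.+ i = unpaired Sign.- i
    unpaired-opposite Sign.- i = unpaired Sign.+ i
    pointwise : ∀ e → pairTerm bit e ℚ.≤ pairTerm bit′ e
    pointwise e = subst (pairTerm bit e ℚ.≤_)
      (sym (cong₂ ℚ._+_
        (cong₂ (λ t h → arcTerm t h (lower e) (upper e)) (unpaired (sign₁ e) (end₁ e)) (unpaired-opposite (sign₂ e) (end₂ e)))
        (cong₂ (λ t h → arcTerm t h (lower e) (upper e)) (unpaired (sign₂ e) (end₂ e)) (unpaired-opposite (sign₁ e) (end₁ e)))))
      (arcTerms-uncross (bit (sign₁ e) (end₁ e)) (bit (∼ sign₁ e) (end₁ e))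
        (bit (∼ sign₂ e) (end₂ e)) (bit (sign₂ e) (end₂ e)) (lower≤upper e))

  -- A violating (Y′, Z′) gives the violating set Y′⁺ ∪ Z′⁻ of the same excess, which is at most
  -- that of Y⁺ ∪ Z⁻; removing the pairs from the latter does not lower its excess.
  maximum-cut : ∀ Y Z → S.MaximumViolatingCut (Y ++ Z) → MaximumViolatingCut (Y ─ Z) (Z ─ Y)
  maximum-cut Y Z (violating , maximal) =
    (dis , ≤⁺-<⁺-≤-trans β≤ρ violating κ≤κ̂) ,
    λ Y′ Z′ (dis′ , violating′) →
      let β≡ρ′ = represents Y′ Z′ (⊆⊤ Y′) (⊆⊤ Z′) dis′
          κ̂≡κ′ = κ̂≡κ Y′ Z′ dis′
      in trans-≤⁺ (+∞-mono-≤⁺ (≤⁺-reflexive (cong [_] κ̂≡κ′)) β≤ρ)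
           (trans-≤⁺ (maximal (Y′ ++ Z′) (subst₂ (λ p a → p <⁺ [ a ]) β≡ρ′ κ̂≡κ′ violating′))
             (+∞-mono-≤⁺ [ κ≤κ̂ ] (≤⁺-reflexive (sym β≡ρ′))))
    where
    trans-≤⁺ : ∀ {p q r} → p ≤⁺ q → q ≤⁺ r → p ≤⁺ r
    trans-≤⁺ = ≤⁺-trans ℚ.≤-trans
    dis : Disjoint (Y ─ Z) (Z ─ Y)
    dis = ─-disjoint Y Z
    β≤ρ : β (Y ─ Z) (Z ─ Y) ≤⁺ ρ (Y ++ Z)
    β≤ρ = subst (_≤⁺ ρ (Y ++ Z)) (sym (represents (Y ─ Z) (Z ─ Y) (⊆⊤ (Y ─ Z)) (⊆⊤ (Z ─ Y)) dis)) (t-monotone Y Z (⊆⊤ Y) (⊆⊤ Z))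
    κ≤κ̂ : S.κ (Y ++ Z) ℚ.≤ κ̂ (Y ─ Z) (Z ─ Y)
    κ≤κ̂ = subst (S.κ (Y ++ Z) ℚ.≤_) (sym (κ̂≡κ (Y ─ Z) (Z ─ Y) dis)) (κ-uncross Y Z)

-- Programs

Assignment : Set
Assignment = ℕ × Expr × Expr

assign : List Assignment → Cmd
assign []                  = skip
assign ((a , e , f) ∷ as) = write a e f ⨾ assign as

-- Straight-line code is kept as a list so that its effect and its cost, which is independent of the
-- store, are computed by functions.
exec : List Assignment → Store → Store
exec []                  s = s
exec ((a , e , f) ∷ as) s = exec as (s [ a , ⟦ e ⟧ s ≔ ⟦ f ⟧ s ])

cost : List Assignment → ℕ
cost []                  = 1
cost ((a , e , f) ∷ as) = suc (size e + size f) + cost as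

-- A strict upper bound on the numbers of the arrays written to; arrays that are only read do not
-- count.
bound : Cmd → ℕ
bound skip           = 0
bound (write a e f)  = suc a
bound (c ⨾ d)        = bound c ℕ.⊔ bound d
bound (if≤ e f c d)  = bound c ℕ.⊔ bound d
bound (while≤ e f c) = bound c
bound (query x i j r) = suc r

≔-hit : ∀ {i j : ℤ} {v w : ℤ} → i ≡ j → (if does (i ℤ.≟ j) then v else w) ≡ v
≔-hit {i} {j} i≡j rewrite dec-true (i ℤ.≟ j) i≡j = refl

≔-miss : ∀ {i j : ℤ} {v w : ℤ} → i ≢ j → (if does (i ℤ.≟ j) then v else w) ≡ w
≔-miss {i} {j} i≢j rewrite dec-false (i ℤ.≟ j) i≢j = refl

≔-other : ∀ (s : Store) i {a b} {j v} → a ≢ b → (s [ a , i ≔ v ]) b j ≡ s b j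
≔-other s i {a} {b} a≢b rewrite dec-false (a ℕ.≟ b) a≢b = refl

≔-same : ∀ (s : Store) a i {j v} → (s [ a , i ≔ v ]) a j ≡ (if does (i ℤ.≟ j) then v else s a j)
≔-same s a i rewrite dec-true (a ℕ.≟ a) refl = refl

pos-injective : ∀ {i j : Fin k} → pos i ≡ pos j → i ≡ j
pos-injective = Fin.toℕ-injective ∘ ℤ.+-injective

pos-↑ˡ : ∀ (i : Fin m) n → pos (i ↑ˡ n) ≡ pos i
pos-↑ˡ i n = cong +_ (Fin.toℕ-↑ˡ i n)

pos-↑ʳ : ∀ m (i : Fin n) → pos (m ↑ʳ i) ≡ + m ℤ.+ pos i
pos-↑ʳ m i = cong +_ (Fin.toℕ-↑ʳ m i)

module _ {O : Oracle} {η : ℕ} where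

  assign-run : ∀ as s → Run O η (assign as) s (cost as) (exec as s)
  assign-run []       s = skip
  assign-run (_ ∷ as) s = write ⨾ assign-run as _

  -- Commands name their arrays by literals, so the syntax alone limits what can change. Induction
  -- is on the run, which unrolls the loops.
  untouched : ∀ {c s t s′} → Run O η c s t s′ → ∀ {a} → bound c ℕ.≤ a → ∀ i → s′ a i ≡ s a i
  untouched skip                  c≤a i = refl
  untouched (write {s} {e = e})   c≤a i = ≔-other s (⟦ e ⟧ s) (ℕ.<⇒≢ c≤a)
  untouched (_⨾_ {c = c} {d} r r′) c≤a i = trans
    (untouched r′ (ℕ.≤-trans (ℕ.m≤n⊔m (bound c) (bound d)) c≤a) i)
    (untouched r (ℕ.≤-trans (ℕ.m≤m⊔n (bound c) (bound d)) c≤a) i)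
  untouched (if-true {c = c} {d} _ r)   c≤a i = untouched r (ℕ.≤-trans (ℕ.m≤m⊔n (bound c) (bound d)) c≤a) i
  untouched (if-false {c = c} {d} _ r)  c≤a i = untouched r (ℕ.≤-trans (ℕ.m≤n⊔m (bound c) (bound d)) c≤a) i
  untouched (while-true _ r r′)   c≤a i = trans (untouched r′ c≤a i) (untouched r c≤a i)
  untouched (while-false _)       c≤a i = refl
  untouched (query {s} {x} {i′} {j} {r}) c≤a i with O (s x) (⟦ i′ ⟧ s) (⟦ j ⟧ s)
  ... | [ v ] = trans (≔-other (s [ r , + 0 ≔ + 1 ]) (+ 1) (ℕ.<⇒≢ c≤a)) (≔-other s (+ 0) (ℕ.<⇒≢ c≤a))
  ... | ⊤⁺    = ≔-other s (+ 0) (ℕ.<⇒≢ c≤a)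

-- The driver keeps its data in an array that the subroutine does not write:
-- the loop counter in cell 0, the numbers of nodes and edges in cells -1 and
-- 2.  Together with the 0 in cell 1, cell s then holds the offset from the
-- number of i to the number of i^s.
module Driver (spare : ℕ) where

  -- The arrays 0 to 9 belong to the input and output format. With the literal 10 in front,
  -- comparisons with these numbers reduce even though `spare` is a variable.
  data-array : ℕ
  data-array = 10 + spare

  counter nodes edges : Expr
  counter = read data-array (lit (+ 0))
  nodes   = read data-array (lit (ℤ.- + 1))
  edges   = read data-array (lit (+ 2))

  increment : Assignment
  increment = data-array , lit (+ 0) , counter ⊕ lit (+ 1)

  loop-body : List Assignment → List Assignment
  loop-body as = as List.++ increment ∷ []

  -- The language tests only `≤`; the added 1 makes the test strict.
  for : Expr → List Assignment → Cmd
  for limit as = while≤ (counter ⊕ lit (+ 1)) limit (assign (loop-body as))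

  guard-cost iteration-cost : Expr → List Assignment → ℕ
  guard-cost     limit as = suc (size (counter ⊕ lit (+ 1)) + size limit)
  iteration-cost limit as = guard-cost limit as + cost (loop-body as)

  -- Induction on the number of iterations left. The last `guard-cost` pays for the failing test.
  for-run : ∀ {O η} limit as K (Inv : ℕ → Store → Set) →
            (∀ {k s} → Inv k s → s data-array (+ 0) ≡ + k × ⟦ limit ⟧ s ≡ + K) →
            (∀ {k s} → k ℕ.< K → Inv k s → Inv (suc k) (exec (loop-body as) s)) →
            ∀ {s} → Inv 0 s →
            ∃[ s′ ] (Run O η (for limit as) s (K * iteration-cost limit as + guard-cost limit as) s′ × Inv K s′)
  for-run {O} {η} limit as K Inv reads step = from K (ℕ.+-identityʳ K)
    where
    T : ℕ → ℕ
    T d = d * iteration-cost limit as + guard-cost limit as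
    from : ∀ d {k} → d + k ≡ K → ∀ {s} → Inv k s →
           ∃[ s′ ] (Run O η (for limit as) s (T d) s′ × Inv K s′)
    from ℕ.zero {k} refl {s} inv with counter≡ , limit≡ ← reads inv =
      s , while-false (λ le → ℕ.<-irrefl refl (ℤ.drop‿+≤+ (subst₂ ℤ._≤_
        (trans (cong (ℤ._+ + 1) counter≡) (cong +_ (ℕ.+-comm k 1))) limit≡ le))) , inv
    from (suc d) {k} refl {s} inv with counter≡ , limit≡ ← reads inv =
      let s′ , r , inv′ = from d (ℕ.+-suc d k) (step (ℕ.s≤s (ℕ.m≤n+m k d)) inv)
      in s′ , subst (λ t → Run O η (for limit as) s t s′) time
           (while-true (subst₂ ℤ._≤_ (sym (trans (cong (ℤ._+ + 1) counter≡) (cong +_ (ℕ.+-comm k 1)))) (sym limit≡)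
               (ℤ.+≤+ (ℕ.s≤s (ℕ.m≤n+m k d))))
             (assign-run (loop-body as) s) r) , inv′
      where
      time : guard-cost limit as + (cost (loop-body as) + T d) ≡ T (suc d)
      time = begin
        g + (c + (d * (g + c) + g))     ≡⟨ ℕ.+-assoc g c _ ⟨
        (g + c) + (d * (g + c) + g)     ≡⟨ ℕ.+-assoc (g + c) (d * (g + c)) g ⟨
        T (suc d)                       ∎
        where
        open ≡-Reasoning
        g c : ℕ
        g = guard-cost limit as
        c = cost (loop-body as)

  combine : Sign → Expr → Expr → Expr
  combine Sign.+ = _⊕_
  combine Sign.- = _⊖_

  ⟦_⟧ˢ : Sign → ℤ → ℤ → ℤ
  ⟦ Sign.+ ⟧ˢ = ℤ._+_
  ⟦ Sign.- ⟧ˢ = ℤ._-_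

  ⟦combine⟧ : ∀ σ e f s → ⟦ combine σ e f ⟧ s ≡ ⟦ σ ⟧ˢ (⟦ e ⟧ s) (⟦ f ⟧ s)
  ⟦combine⟧ Sign.+ e f s = refl
  ⟦combine⟧ Sign.- e f s = refl

  -- One loop serves both outputs: sums turn φ into 2ψ, and differences turn the characteristic
  -- vector of a cut into χ_{Y,Z}.
  fold-body : Sign → Expr → List Assignment
  fold-body σ limit = (result , counter , combine σ (read result counter) (read result (limit ⊕ counter))) ∷ []

  -- Working in place is safe: entry e is read for the last time in the iteration that overwrites
  -- it, and the upper half is never written. `+ 0 ≢ c` keeps the counter off the cell of the limit.
  fold-run : ∀ {O η} σ c K {s₀} → + 0 ≢ c → s₀ data-array (+ 0) ≡ + 0 → s₀ data-array c ≡ + K →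
    let limit = read data-array (lit c) ; as = fold-body σ limit in
    ∃[ s′ ] (Run O η (for limit as) s₀ (K * iteration-cost limit as + guard-cost limit as) s′ ×
      (∀ (e : Fin K) → s′ result (pos e) ≡ ⟦ σ ⟧ˢ (s₀ result (pos (e ↑ˡ K))) (s₀ result (pos (K ↑ʳ e)))) ×
      s′ flag (+ 0) ≡ s₀ flag (+ 0))
  fold-run {O} {η} σ c K {s₀} 0≢c counter≡ limit≡ =
    let s′ , r , inv = for-run limit as K Inv (λ inv → Inv.counter-value inv , Inv.limit-value inv) step record
          { counter-value = counter≡ ; limit-value = limit≡ ; flag-value = refl ; high = λ _ → refl
          ; pending = λ _ _ → refl ; done = λ _ () }
    in s′ , r , (λ e → Inv.done inv e (Fin.toℕ<n e)) , Inv.flag-value inv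
    where
    limit : Expr
    limit = read data-array (lit c)
    as : List Assignment
    as = fold-body σ limit
    record Inv (k : ℕ) (s : Store) : Set where
      field
        counter-value : s data-array (+ 0) ≡ + k
        limit-value   : s data-array c ≡ + K
        flag-value    : s flag (+ 0) ≡ s₀ flag (+ 0)
        high    : ∀ (e : Fin K) → s result (pos (K ↑ʳ e)) ≡ s₀ result (pos (K ↑ʳ e))
        pending : ∀ (e : Fin K) → k ℕ.≤ toℕ e → s result (pos (e ↑ˡ K)) ≡ s₀ result (pos (e ↑ˡ K))
        done    : ∀ (e : Fin K) → toℕ e ℕ.< k →
                  s result (pos e) ≡ ⟦ σ ⟧ˢ (s₀ result (pos (e ↑ˡ K))) (s₀ result (pos (K ↑ʳ e)))
    step : ∀ {k s} → k ℕ.< K → Inv k s → Inv (suc k) (exec (loop-body as) s)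
    step {k} {s} k<K inv = record
      { counter-value = trans (≔-same s₁ data-array (+ 0)) (trans (cong (ℤ._+ + 1) I.counter-value) (cong +_ (ℕ.+-comm k 1)))
      ; limit-value   = trans (≔-same s₁ data-array (+ 0)) (trans (≔-miss 0≢c) I.limit-value)
      ; flag-value    = I.flag-value
      ; high    = λ e → trans (≔-miss (at≢ (K ↑ʳ e) λ eq → ℕ.<⇒≢ k<K
                    (ℕ.≤-antisym (ℕ.<⇒≤ k<K) (subst (K ℕ.≤_) (trans (sym (Fin.toℕ-↑ʳ K e)) (sym eq)) (ℕ.m≤m+n K (toℕ e)))))) (I.high e)
      ; pending = λ e k<e → trans (≔-miss (at≢ (e ↑ˡ K) λ eq → ℕ.<⇒≢ k<e (trans eq (Fin.toℕ-↑ˡ e K))))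
                    (I.pending e (ℕ.<⇒≤ k<e))
      ; done    = λ e e<1+k → finish e (ℕ.m≤n⇒m<n∨m≡n (ℕ.s≤s⁻¹ e<1+k))
      }
      where
      module I = Inv inv
      s₁ : Store
      s₁ = exec as s
      at≢ : ∀ {j} (e : Fin j) → k ≢ toℕ e → s data-array (+ 0) ≢ pos e
      at≢ e k≢e eq = k≢e (ℤ.+-injective (trans (sym I.counter-value) eq))
      finish : ∀ e → toℕ e ℕ.< k ⊎ toℕ e ≡ k →
               exec (loop-body as) s result (pos e) ≡ ⟦ σ ⟧ˢ (s₀ result (pos (e ↑ˡ K))) (s₀ result (pos (K ↑ʳ e)))
      finish e (inj₁ e<k) = trans (≔-miss (at≢ e (ℕ.<⇒≢ e<k ∘ sym))) (I.done e e<k)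
      finish e (inj₂ refl) = begin
        s₁ result (pos e)
          ≡⟨ ≔-hit I.counter-value ⟩
        ⟦ combine σ (read result counter) (read result (limit ⊕ counter)) ⟧ s
          ≡⟨ ⟦combine⟧ σ _ _ s ⟩
        ⟦ σ ⟧ˢ (s result (s data-array (+ 0))) (s result (s data-array c ℤ.+ s data-array (+ 0)))
          ≡⟨ cong₂ (λ i j → ⟦ σ ⟧ˢ (s result i) (s result j))
               (trans I.counter-value (sym (pos-↑ˡ e K)))
               (trans (cong₂ ℤ._+_ I.limit-value I.counter-value) (sym (pos-↑ʳ K e))) ⟩
        ⟦ σ ⟧ˢ (s result (pos (e ↑ˡ K))) (s result (pos (K ↑ʳ e)))
          ≡⟨ cong₂ ⟦ σ ⟧ˢ (I.pending e ℕ.≤-refl) (I.high e) ⟩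
        ⟦ σ ⟧ˢ (s₀ result (pos (e ↑ˡ K))) (s₀ result (pos (K ↑ʳ e))) ∎
        where open ≡-Reasoning

  -- The order matters: arc m + e is built while the ends of edge e are still in place, and only
  -- then are they replaced by those of arc e. Using the sign as an index into the offsets avoids
  -- branching. The capacities of arc e are already where they belong.
  double-body : List Assignment
  double-body =
    (ends₁  , edges ⊕ counter , read ends₂ counter ⊕ read data-array (read signs₂ counter)) ∷
    (ends₂  , edges ⊕ counter , read ends₁ counter ⊕ read data-array (lit (+ 0) ⊖ read signs₁ counter)) ∷
    (ends₁  , counter         , read ends₁ counter ⊕ read data-array (read signs₁ counter)) ∷
    (ends₂  , counter         , read ends₂ counter ⊕ read data-array (lit (+ 0) ⊖ read signs₂ counter)) ∷
    (lowers , edges ⊕ counter , read lowers counter) ∷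
    (uppers , edges ⊕ counter , read uppers counter) ∷ []

  offset : ℕ → Sign → ℤ
  offset n Sign.+ = + 0
  offset n Sign.- = + n

  pos-node : ∀ σ (i : Fin n) → pos i ℤ.+ offset n σ ≡ pos (node σ i)
  pos-node {n} Sign.+ i = trans (ℤ.+-identityʳ (pos i)) (sym (pos-↑ˡ i n))
  pos-node {n} Sign.- i = trans (ℤ.+-comm (pos i) (+ n)) (sym (pos-↑ʳ n i))

  module Doubling {n m} (I : BisubmodularFlow n m) {ρ : Subset (n + n) → ℚ∞}
                  (reducible : ReducibleOn ⊤ (BisubmodularFlow.β I) ρ)
                  (a-base : ∃[ x ] Base ⊤ ρ x) where
    open BisubmodularFlow I
    open Skew I reducible a-base

    record Pending (s : Store) (e : Fin m) : Set where
      field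
        first-end  : s ends₁ (pos (e ↑ˡ m)) ≡ pos (end₁ e)
        second-end : s ends₂ (pos (e ↑ˡ m)) ≡ pos (end₂ e)
        low        : fromℤ (s lowers (pos (e ↑ˡ m))) ≡ lower e
        up         : fromℤ (s uppers (pos (e ↑ˡ m))) ≡ upper e

    record Done (s : Store) (a : Fin (m + m)) : Set where
      field
        tail-node : s ends₁ (pos a) ≡ pos (tails a)
        head-node : s ends₂ (pos a) ≡ pos (heads a)
        low       : fromℤ (s lowers (pos a)) ≡ lowers′ a
        up        : fromℤ (s uppers (pos a)) ≡ uppers′ a

    record Inv (k : ℕ) (s : Store) : Set where
      field
        counter-value : s data-array (+ 0) ≡ + k
        plus-offset   : s data-array (+ 1) ≡ + 0
        minus-offset  : s data-array (ℤ.- + 1) ≡ + n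
        edge-count    : s data-array (+ 2) ≡ + m
        first-signs   : HoldsSigns (s signs₁) sign₁
        second-signs  : HoldsSigns (s signs₂) sign₂
        holds-base    : HoldsBase ρ (s base)
        pending       : ∀ e → k ℕ.≤ toℕ e → Pending s e
        done          : ∀ e → toℕ e ℕ.< k → Done s (e ↑ˡ m) × Done s (m ↑ʳ e)

    step : ∀ {k s} → k ℕ.< m → Inv k s → Inv (suc k) (exec (loop-body double-body) s)
    step {k} {s} k<m inv = record
      { counter-value = trans (≔-same s₀ data-array (+ 0) {+ 0}) (trans (cong (ℤ._+ + 1) I.counter-value) (cong +_ (ℕ.+-comm k 1)))
      ; plus-offset   = trans (≔-same s₀ data-array (+ 0) {+ 1}) I.plus-offset
      ; minus-offset  = trans (≔-same s₀ data-array (+ 0) {ℤ.- + 1}) I.minus-offset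
      ; edge-count    = trans (≔-same s₀ data-array (+ 0) {+ 2}) I.edge-count
      ; first-signs   = I.first-signs
      ; second-signs  = I.second-signs
      ; holds-base    = I.holds-base
      ; pending       = λ e k<e → still-pending e (λ e≡e₀ → ℕ.<⇒≢ k<e (trans (sym toℕ-e₀) (cong toℕ (sym e≡e₀))))
                                    (I.pending e (ℕ.<⇒≤ k<e))
      ; done          = λ e e<1+k → finish e (ℕ.m≤n⇒m<n∨m≡n (ℕ.s≤s⁻¹ e<1+k))
      }
      where
      module I = Inv inv
      s₀ s₁ : Store
      s₀ = exec double-body s
      s₁ = exec (loop-body double-body) s
      e₀ : Fin m
      e₀ = fromℕ< k<m
      toℕ-e₀ : toℕ e₀ ≡ k
      toℕ-e₀ = Fin.toℕ-fromℕ< k<m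
      module P = Pending (I.pending e₀ (ℕ.≤-reflexive (sym toℕ-e₀)))

      -- The cells of the two arcs of edge `e₀`, as the program computes them. Since they differ, a
      -- read at `i` after a write at `j` still sees the original entry.
      i j : ℤ
      i = s data-array (+ 0)
      j = s data-array (+ 2) ℤ.+ s data-array (+ 0)
      i≡e₀ : i ≡ pos e₀
      i≡e₀ = trans I.counter-value (cong +_ (sym toℕ-e₀))
      i≡lo : i ≡ pos (e₀ ↑ˡ m)
      i≡lo = trans i≡e₀ (sym (pos-↑ˡ e₀ m))
      j≡hi : j ≡ pos (m ↑ʳ e₀)
      j≡hi = trans (cong₂ ℤ._+_ I.edge-count i≡e₀) (sym (pos-↑ʳ m e₀))
      i≢ : ∀ {a} → a ≢ e₀ ↑ˡ m → i ≢ pos a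
      i≢ a≢lo i≡a = a≢lo (pos-injective (trans (sym i≡a) i≡lo))
      j≢ : ∀ {a} → a ≢ m ↑ʳ e₀ → j ≢ pos a
      j≢ a≢hi j≡a = a≢hi (pos-injective (trans (sym j≡a) j≡hi))
      j≢i : j ≢ i
      j≢i j≡i = j≢ (↑ˡ≢↑ʳ e₀ e₀) (trans j≡i i≡lo)
      i≢hi : i ≢ pos (m ↑ʳ e₀)
      i≢hi = i≢ (↑ˡ≢↑ʳ e₀ e₀ ∘ sym)

      offset-at : ∀ σ → s data-array (σ ◃ 1) ≡ offset n σ
      offset-at Sign.+ = I.plus-offset
      offset-at Sign.- = I.minus-offset
      offset-at-opposite : ∀ σ → s data-array (+ 0 ℤ.- (σ ◃ 1)) ≡ offset n (Sign.opposite σ)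
      offset-at-opposite Sign.+ = I.minus-offset
      offset-at-opposite Sign.- = I.plus-offset
      sign₁-at : s signs₁ i ≡ sign₁ e₀ ◃ 1
      sign₁-at = trans (cong (s signs₁) i≡e₀) (I.first-signs e₀)
      sign₂-at : s signs₂ i ≡ sign₂ e₀ ◃ 1
      sign₂-at = trans (cong (s signs₂) i≡e₀) (I.second-signs e₀)
      end₁-at : s ends₁ i ≡ pos (end₁ e₀)
      end₁-at = trans (cong (s ends₁) i≡lo) P.first-end
      end₂-at : s ends₂ i ≡ pos (end₂ e₀)
      end₂-at = trans (cong (s ends₂) i≡lo) P.second-end

      node-at : ∀ {x o} {v : Fin n} {σ τ} → x ≡ pos v → s data-array o ≡ offset n τ → σ ≡ node τ v →
                x ℤ.+ s data-array o ≡ pos σ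
      node-at {v = v} {τ = τ} x≡v o≡τ refl = trans (cong₂ ℤ._+_ x≡v o≡τ) (pos-node τ v)

      lo-done : Done s₁ (e₀ ↑ˡ m)
      lo-done = record
        { tail-node = trans (≔-hit i≡lo) (node-at (trans (≔-miss j≢i) end₁-at)
            (trans (cong (s data-array) sign₁-at) (offset-at (sign₁ e₀))) (tails-ˡ e₀))
        ; head-node = trans (≔-hit i≡lo) (node-at (trans (≔-miss j≢i) end₂-at)
            (trans (cong (λ z → s data-array (+ 0 ℤ.- z)) sign₂-at) (offset-at-opposite (sign₂ e₀))) (heads-ˡ e₀))
        ; low       = trans (cong fromℤ (≔-miss (j≢ (↑ˡ≢↑ʳ e₀ e₀)))) (trans P.low (sym (F.lookup-++ˡ lower lower e₀)))
        ; up        = trans (cong fromℤ (≔-miss (j≢ (↑ˡ≢↑ʳ e₀ e₀)))) (trans P.up (sym (F.lookup-++ˡ upper upper e₀)))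
        }
      hi-done : Done s₁ (m ↑ʳ e₀)
      hi-done = record
        { tail-node = trans (≔-miss i≢hi) (trans (≔-hit j≡hi) (node-at end₂-at
            (trans (cong (s data-array) sign₂-at) (offset-at (sign₂ e₀))) (tails-ʳ e₀)))
        ; head-node = trans (≔-miss i≢hi) (trans (≔-hit j≡hi) (node-at (trans (≔-miss j≢i) end₁-at)
            (trans (cong (λ z → s data-array (+ 0 ℤ.- z)) sign₁-at) (offset-at-opposite (sign₁ e₀))) (heads-ʳ e₀)))
        ; low       = trans (cong fromℤ (trans (≔-hit j≡hi) (cong (s lowers) i≡lo))) (trans P.low (sym (F.lookup-++ʳ lower lower e₀)))
        ; up        = trans (cong fromℤ (trans (≔-hit j≡hi) (cong (s uppers) i≡lo))) (trans P.up (sym (F.lookup-++ʳ upper upper e₀)))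
        }

      still-pending : ∀ e → e ≢ e₀ → Pending s e → Pending s₁ e
      still-pending e e≢e₀ p = record
        { first-end  = trans (≔-miss i≢lo) (trans (≔-miss j≢lo) (Pending.first-end p))
        ; second-end = trans (≔-miss i≢lo) (trans (≔-miss j≢lo) (Pending.second-end p))
        ; low        = trans (cong fromℤ (≔-miss j≢lo)) (Pending.low p)
        ; up         = trans (cong fromℤ (≔-miss j≢lo)) (Pending.up p)
        }
        where
        i≢lo : i ≢ pos (e ↑ˡ m)
        i≢lo = i≢ (e≢e₀ ∘ Fin.↑ˡ-injective m e e₀)
        j≢lo : j ≢ pos (e ↑ˡ m)
        j≢lo = j≢ (↑ˡ≢↑ʳ e e₀)
      still-done : ∀ {a} → a ≢ e₀ ↑ˡ m → a ≢ m ↑ʳ e₀ → Done s a → Done s₁ a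
      still-done a≢lo a≢hi d = record
        { tail-node = trans (≔-miss (i≢ a≢lo)) (trans (≔-miss (j≢ a≢hi)) (Done.tail-node d))
        ; head-node = trans (≔-miss (i≢ a≢lo)) (trans (≔-miss (j≢ a≢hi)) (Done.head-node d))
        ; low       = trans (cong fromℤ (≔-miss (j≢ a≢hi))) (Done.low d)
        ; up        = trans (cong fromℤ (≔-miss (j≢ a≢hi))) (Done.up d)
        }
      finish : ∀ e → toℕ e ℕ.< k ⊎ toℕ e ≡ k → Done s₁ (e ↑ˡ m) × Done s₁ (m ↑ʳ e)
      finish e (inj₁ e<k) =
        still-done (e≢e₀ ∘ Fin.↑ˡ-injective m e e₀) (↑ˡ≢↑ʳ e e₀) (proj₁ (I.done e e<k)) ,
        still-done (↑ˡ≢↑ʳ e₀ e ∘ sym) (e≢e₀ ∘ Fin.↑ʳ-injective m e e₀) (proj₂ (I.done e e<k))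
        where
        e≢e₀ : e ≢ e₀
        e≢e₀ e≡e₀ = ℕ.<⇒≢ e<k (trans (cong toℕ e≡e₀) toℕ-e₀)
      finish e (inj₂ e≡k) with refl ← Fin.toℕ-injective (trans e≡k (sym toℕ-e₀)) = lo-done , hi-done

    double-run : ∀ {O η s} → Inv 0 s →
      ∃[ s′ ] (Run O η (for edges double-body) s (m * iteration-cost edges double-body + guard-cost edges double-body) s′ × Inv m s′)
    double-run = for-run edges double-body m Inv (λ inv → Inv.counter-value inv , Inv.edge-count inv) step

  setup resize reset : List Assignment
  setup =
    (data-array , lit (+ 0)     , lit (+ 0)) ∷
    (data-array , lit (+ 1)     , lit (+ 0)) ∷
    (data-array , lit (ℤ.- + 1) , read sizes (lit (+ 0))) ∷
    (data-array , lit (+ 2)     , read sizes (lit (+ 1))) ∷ []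
  resize = (sizes , lit (+ 0) , nodes ⊕ nodes) ∷ (sizes , lit (+ 1) , edges ⊕ edges) ∷ []
  reset  = (data-array , lit (+ 0) , lit (+ 0)) ∷ []

  program : Cmd → Cmd
  program Q =
    assign setup ⨾ for edges double-body ⨾ assign resize ⨾ Q ⨾ assign reset ⨾
    if≤ (read flag (lit (+ 0))) (lit (+ 0))
      (for edges (fold-body Sign.+ edges))
      (for nodes (fold-body Sign.- nodes))

  module _ {n m} (I : BisubmodularFlow n m) {ρ : Subset (n + n) → ℚ∞}
           (reducible : ReducibleOn ⊤ (BisubmodularFlow.β I) ρ)
           (a-base : ∃[ x ] Base ⊤ ρ x) where
    open Skew I reducible a-base
    open Doubling I reducible a-base

    setup-establishes : ∀ {s} → BisubmodularFlowInput I ρ s → Inv 0 (exec setup s)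
    setup-establishes {s} input = record
      { counter-value = proj₁ cells
      ; plus-offset   = proj₁ (proj₂ cells)
      ; minus-offset  = trans (proj₁ (proj₂ (proj₂ cells))) In.#nodes
      ; edge-count    = trans (proj₂ (proj₂ (proj₂ cells))) In.#edges
      ; first-signs   = proj₁ In.signs
      ; second-signs  = proj₂ In.signs
      ; holds-base    = In.a-base
      ; pending       = λ e _ → record
          { first-end  = trans (cong (s ends₁) (pos-↑ˡ e m)) (In.firsts e)
          ; second-end = trans (cong (s ends₂) (pos-↑ˡ e m)) (In.seconds e)
          ; low        = trans (cong (fromℤ ∘ s lowers) (pos-↑ˡ e m)) (In.lows e)
          ; up         = trans (cong (fromℤ ∘ s uppers) (pos-↑ˡ e m)) (In.ups e)
          }
      ; done          = λ _ ()
      }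
      where
      module In = BisubmodularFlowInput input
      cells : exec setup s data-array (+ 0) ≡ + 0 × exec setup s data-array (+ 1) ≡ + 0 ×
              exec setup s data-array (ℤ.- + 1) ≡ s sizes (+ 0) × exec setup s data-array (+ 2) ≡ s sizes (+ 1)
      cells rewrite dec-true (data-array ℕ.≟ data-array) refl = refl , refl , refl , refl

    -- The base passes unchanged, because both input formats number U^± in the same way.
    resize-establishes : ∀ {s} → Inv m s → SubmodularFlowInput skew (exec resize s)
    resize-establishes {s} inv = record
      { #nodes = cong₂ ℤ._+_ I.minus-offset I.minus-offset
      ; #arcs  = cong₂ ℤ._+_ I.edge-count I.edge-count
      ; tails  = Done.tail-node ∘ all-done
      ; heads  = Done.head-node ∘ all-done
      ; lows   = Done.low ∘ all-done
      ; ups    = Done.up ∘ all-done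
      ; a-base = I.holds-base
      }
      where
      module I = Inv inv
      all-done : ∀ a → Done s a
      all-done = split-elim m (Done s) (λ e → proj₁ (I.done e (Fin.toℕ<n e))) (λ e → proj₂ (I.done e (Fin.toℕ<n e)))

-- Correctness and running time of the reduction

halve-double : ∀ p q → fromℤ (+ 2) ℚ.* ((p ℚ.+ q) ℚ.* ½) ≡ p ℚ.+ q
halve-double = solve 2 (λ p q → con (fromℤ (+ 2)) :* ((p :+ q) :* con ½) := p :+ q) refl
  where open +-*-Solver

-- Elements of both Y and Z cancel in the difference, so the final loop removes mirror pairs without
-- testing for them.
χ-─ : ∀ (Y Z : Subset n) i → χ (Y ─ Z) (Z ─ Y) i ≡ 𝟙 Y i ℚ.- 𝟙 Z i
χ-─ Y Z i rewrite lookup-─ Y Z i | lookup-─ Z Y i with lookup Y i | lookup Z i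
... | true  | true  = refl
... | true  | false = refl
... | false | true  = refl
... | false | false = refl

module Reduction {SF : ℕ → ℕ → ℕ → ℕ} (regular : RegularBound SF)
                 {Q : Cmd} (solves : SolvesSubmodularFlow Q SF) where
  open RegularBound regular
  open Driver (bound Q)

  loop-cost : Expr → List Assignment → ℕ
  loop-cost limit as = iteration-cost limit as + guard-cost limit as

  -- The total of the coefficients of all program segments, nested as `_⊹_` associates. The 1 stands
  -- for the call of `Q`; the costs of the two final loops are added, which bounds either branch.
  test-cost overhead : ℕ
  test-cost = suc (size (read flag (lit (+ 0))) + size (lit (+ 0)))
  overhead =
    cost setup + (loop-cost edges double-body + (cost resize + (1 + (cost reset + (test-cost +
      (loop-cost edges (fold-body Sign.+ edges) + loop-cost nodes (fold-body Sign.- nodes)))))))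

  -- `B` is the unit of time: by `RegularBound` it exceeds n + m and bounds the call of `Q` on the
  -- doubled graph.
  module Time (n m η : ℕ) where
    B : ℕ
    B = K * SF n m η

    infix 4 _⊑_
    -- A record, so that unification recovers the coefficient `a`, which cannot be read off from
    -- `a * B`.
    record _⊑_ (t a : ℕ) : Set where
      constructor bounded
      field
        in-time : t ℕ.≤ a * B

    infixr 5 _⊹_
    _⊹_ : ∀ {x y a b} → x ⊑ a → y ⊑ b → x + y ⊑ a + b
    _⊹_ {x} {y} {a} {b} (bounded x≤) (bounded y≤) =
      bounded (subst (x + y ℕ.≤_) (sym (ℕ.*-distribʳ-+ B a b)) (ℕ.+-mono-≤ x≤ y≤))

    constant : ∀ c → c ⊑ c
    constant c = bounded (subst (ℕ._≤ c * B) (ℕ.*-identityʳ c)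
      (ℕ.*-monoʳ-≤ c (ℕ.≤-trans (ℕ.s≤s ℕ.z≤n) (linear n m η))))

    for-loop : ∀ {k} limit as → k ℕ.≤ n + m →
               k * iteration-cost limit as + guard-cost limit as ⊑ loop-cost limit as
    for-loop {k} limit as k≤n+m = bounded
      (subst (k * c ℕ.≤_) (ℕ.*-comm B c) (ℕ.*-monoˡ-≤ c (ℕ.≤-trans k≤n+m (ℕ.<⇒≤ (linear n m η)))))
      ⊹ constant (guard-cost limit as)
      where
      c : ℕ
      c = iteration-cost limit as

    subroutine : ∀ {t} → t ℕ.≤ SF (n + n) (m + m) η → t ⊑ 1
    subroutine {t} t≤ = bounded (subst (t ℕ.≤_) (sym (ℕ.*-identityˡ B)) (ℕ.≤-trans t≤ (doubling n m η)))

    weakenʳ : ∀ {x a} b → x ⊑ a → x ⊑ a + b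
    weakenʳ {a = a} b (bounded x≤) = bounded (ℕ.≤-trans x≤ (ℕ.*-monoˡ-≤ B (ℕ.m≤m+n a b)))

    weakenˡ : ∀ {x b} a → x ⊑ b → x ⊑ a + b
    weakenˡ {b = b} a (bounded x≤) = bounded (ℕ.≤-trans x≤ (ℕ.*-monoˡ-≤ B (ℕ.m≤n+m b a)))

  -- Common core of both parts. The premise on `Wanted` sees φ before halving, since its integrality
  -- and its boundary are no longer visible in `halve φ`.
  flow-or-cut : ∀ {n m} (I : BisubmodularFlow n m) {ρ : Subset (n + n) → ℚ∞} {Wanted : (Fin m → ℚ) → Set} →
    BisubmodularFlow.IntegralCapacities I →
    (reducible : ReducibleOn ⊤ (BisubmodularFlow.β I) ρ) →
    IntegralOn (⊤ {n} ±) ρ →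
    (∀ a-base φ → (∀ a → Integral (φ a)) → Base ⊤ ρ (Skew.S.boundary I reducible a-base φ) → Wanted (halve φ)) →
    ObtainsFlowOrCut (program Q) (λ η → overhead * K * SF n m η) I ρ Wanted
  flow-or-cut {n} {m} I {ρ} {Wanted} capacities reducible ρ∈ℤ wanted O oracle η s₀ input =
    let s₂ , run₂ , inv = double-run (setup-establishes I reducible a-base input)
        t , s₃ , run₃ , t≤SF , output = solves skew (integralData capacities ρ∈ℤ) O oracle η
          (exec resize s₂) (resize-establishes I reducible a-base inv)
        s₄ = exec reset s₃
        kept : ∀ i → s₃ data-array i ≡ s₂ data-array i
        kept = untouched run₃ (ℕ.m≤n+m (bound Q) 10)
        cell : ∀ i → s₄ data-array i ≡ (if does (+ 0 ℤ.≟ i) then + 0 else s₂ data-array i)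
        cell i = trans (≔-same s₃ data-array (+ 0)) (cong (if does (+ 0 ℤ.≟ i) then + 0 else_) (kept i))
        t₅ , s₅ , run₅ , t₅≤ , output′ = finish s₄ (cell (+ 0))
          (trans (cell (+ 2)) (Inv.edge-count inv)) (trans (cell (ℤ.- + 1)) (Inv.minus-offset inv)) output
    in _ , s₅ ,
       assign-run setup s₀ ⨾ run₂ ⨾ assign-run resize s₂ ⨾ run₃ ⨾ assign-run reset s₃ ⨾ run₅ ,
       ℕ.≤-trans
         (_⊑_.in-time (constant (cost setup) ⊹ for-loop edges double-body (ℕ.m≤n+m m n) ⊹ constant (cost resize) ⊹
          subroutine t≤SF ⊹ constant (cost reset) ⊹ t₅≤))
         (ℕ.≤-reflexive (sym (ℕ.*-assoc overhead K (SF n m η)))) ,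
       output′
    where
    open BisubmodularFlow I
    open Time n m η
    a-base : ∃[ x ] Base ⊤ ρ x
    a-base = let x , _ , x∈B = BisubmodularFlowInput.a-base input in x , x∈B
    open Skew I reducible a-base
    open Doubling I reducible a-base
    conclude : Cmd
    conclude = if≤ (read flag (lit (+ 0))) (lit (+ 0))
      (for edges (fold-body Sign.+ edges)) (for nodes (fold-body Sign.- nodes))
    finish : ∀ s → s data-array (+ 0) ≡ + 0 → s data-array (+ 2) ≡ + m → s data-array (ℤ.- + 1) ≡ + n →
             SubmodularFlowOutput skew s →
             ∃[ t ] ∃[ s′ ] (Run O η conclude s t s′ ×
               t ⊑ test-cost + (loop-cost edges (fold-body Sign.+ edges) + loop-cost nodes (fold-body Sign.- nodes)) ×
               BisubmodularFlowOutput I Wanted s′)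
    finish s counter≡ edges≡ nodes≡ (inj₁ (flag≡ , φ , holds , feasible)) =
      let s′ , run , sums , flag-kept = fold-run Sign.+ (+ 2) m (λ ()) counter≡ edges≡
          doubled : ∀ e → fromℤ (s′ result (pos e)) ≡ fromℤ (+ 2) ℚ.* halve φ e
          doubled e = begin
            fromℤ (s′ result (pos e))                             ≡⟨ cong fromℤ (sums e) ⟩
            fromℤ (s result (pos (e ↑ˡ m)) ℤ.+ s result (pos (m ↑ʳ e)))
              ≡⟨ fromℤ-homo-+ (s result (pos (e ↑ˡ m))) (s result (pos (m ↑ʳ e))) ⟩
            fromℤ (s result (pos (e ↑ˡ m))) ℚ.+ fromℤ (s result (pos (m ↑ʳ e)))
              ≡⟨ cong₂ ℚ._+_ (holds (e ↑ˡ m)) (holds (m ↑ʳ e)) ⟩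
            φ (e ↑ˡ m) ℚ.+ φ (m ↑ʳ e)                             ≡⟨ halve-double (φ (e ↑ˡ m)) (φ (m ↑ʳ e)) ⟨
            fromℤ (+ 2) ℚ.* halve φ e                             ∎
      in _ , s′ , if-true (subst (ℤ._≤ + 0) (sym flag≡) ℤ.≤-refl) run ,
         constant test-cost ⊹ weakenʳ (loop-cost nodes (fold-body Sign.- nodes))
           (for-loop edges (fold-body Sign.+ edges) (ℕ.m≤n+m m n)) ,
         inj₁ (trans flag-kept flag≡ , halve φ , doubled , halve-feasible φ feasible ,
           -- The array entries themselves are the integers that witness integrality of 2ψ and, on
           -- the next line, of φ.
           (λ e → s′ result (pos e) , sym (doubled e)) ,
           wanted a-base φ (λ a → s result (pos a) , sym (holds a)) (proj₂ feasible))
      where open ≡-Reasoning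
    finish s counter≡ edges≡ nodes≡ (inj₂ (flag≡ , X , holds , maximum))
      with Y , Z , refl ← halves {n} X =
      let s′ , run , differences , flag-kept = fold-run Sign.- (ℤ.- + 1) n (λ ()) counter≡ nodes≡
          holds-χ : Holds (s′ result) (χ (Y ─ Z) (Z ─ Y))
          holds-χ i = begin
            fromℤ (s′ result (pos i))                             ≡⟨ cong fromℤ (differences i) ⟩
            fromℤ (s result (pos (i ↑ˡ n)) ℤ.- s result (pos (n ↑ʳ i)))
              ≡⟨ fromℤ-homo-+ (s result (pos (i ↑ˡ n))) (ℤ.- s result (pos (n ↑ʳ i))) ⟩
            fromℤ (s result (pos (i ↑ˡ n))) ℚ.+ fromℤ (ℤ.- s result (pos (n ↑ʳ i)))
              ≡⟨ cong (fromℤ (s result (pos (i ↑ˡ n))) ℚ.+_) (fromℤ-homo‿- (s result (pos (n ↑ʳ i)))) ⟩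
            fromℤ (s result (pos (i ↑ˡ n))) ℚ.- fromℤ (s result (pos (n ↑ʳ i)))
              ≡⟨ cong₂ ℚ._-_ (trans (holds (i ↑ˡ n)) (cong ⟦_⟧ᵇ (Vec.lookup-++ˡ Y Z i)))
                             (trans (holds (n ↑ʳ i)) (cong ⟦_⟧ᵇ (Vec.lookup-++ʳ Y Z i))) ⟩
            𝟙 Y i ℚ.- 𝟙 Z i                                       ≡⟨ χ-─ Y Z i ⟨
            χ (Y ─ Z) (Z ─ Y) i                                   ∎
      in _ , s′ , if-false (λ le → 1≰0 (subst (ℤ._≤ + 0) flag≡ le)) run ,
         constant test-cost ⊹ weakenˡ (loop-cost edges (fold-body Sign.+ edges))
           (for-loop nodes (fold-body Sign.- nodes) (ℕ.m≤m+n n m)) ,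
         inj₂ (trans flag-kept flag≡ , Y ─ Z , Z ─ Y , holds-χ , maximum-cut Y Z maximum)
      where
      open ≡-Reasoning
      1≰0 : ¬ + 1 ℤ.≤ + 0
      1≰0 (ℤ.+≤+ ())

theorem2p7 : ∀ (SF : ℕ → ℕ → ℕ → ℕ) → RegularBound SF →
    ∀ (Q : Cmd) → SolvesSubmodularFlow Q SF →
    ∃[ P ] ∃[ C ]
    ((∀ {n m} (I : BisubmodularFlow n m) (ρ : Subset (n + n) → ℚ∞) →
    BisubmodularFlow.IntegralCapacities I →
    ReducibleOn ⊤ (BisubmodularFlow.β I) ρ →
    IntegralOn (⊤ {n} ±) ρ →
    ObtainsFlowOrCut P (λ η → C * SF n m η) I ρ (λ _ → Data.Unit.⊤))
    ×
    (∀ {n m ℓ} (I : BisubmodularFlow n m)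
    (U : Fin ℓ → Subset n)
    (βs : Fin ℓ → Subset n → Subset n → ℚ∞)
    (ρs : Fin ℓ → Subset (n + n) → ℚ∞) →
    BisubmodularFlow.IntegralCapacities I →
    IsPartition U →
    Separable U (BisubmodularFlow.β I) βs →
    (∀ t → BisubmodularOn (U t) (βs t)) →
    (∀ t → ReducibleOn (U t) (βs t) (ρs t)) →
    (∀ t → IntegralOn (U t ±) (ρs t)) →
    ObtainsFlowOrCut P (λ η → C * SF n m η) I (⨁ U ρs)
    (λ ψ → ∀ t → Integral (BisubmodularFlow.∇ I ψ ⟨ U t ⟩))))
theorem2p7 SF regular Q solves =
  Driver.program (bound Q) Q , overhead * RegularBound.K regular ,
  (λ I ρ capacities reducible ρ∈ℤ → flow-or-cut I capacities reducible ρ∈ℤ (λ _ _ _ _ → Data.Unit.tt)) ,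
  λ {n} I U βs ρs capacities partition separable _ reducible ρs∈ℤ →
    let open DirectSum (λ t → U t ±) ρs
        sum-reducible = ⨁-reducible partition separable reducible
    in flow-or-cut I capacities sum-reducible
         (subst (λ G → IntegralOn G (⨁ U ρs)) (sym (⊤±≡⊤ n)) (integral ρs∈ℤ))
         -- The reducibility of ρ_t itself is applied to ∂φ as a base of block t; that of the direct
         -- sum would yield only the total over all of U^±.
         λ a-base φ φ∈ℤ bd∈B t → subst Integral
           (sym (⟨⟩-cong (Skew.∇-halve I sum-reducible a-base φ) (U t)))
           (base⇒Φ-integral (reducible t)
             (base⇒bases (±-partition U partition) (λ t → proj₁ (ReducibleOn.submodular (reducible t))) bd∈B t)
             (Skew.boundary-integral I sum-reducible a-base φ φ∈ℤ))
  where open Reduction regular solves
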